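{- Let $n \geq 6$ and $k \geq 1$ be integers. Let $H$ be a graph of order $n$ with exactly $k$ connected components, each of which is a cycle of even length at least $6$. Let $G$ be a finite simple bipartite graph with bipartition $(X,Y)$ such that $|X| = |Y| \geq n/2$. If the minimum degree of $G$ satisfies $\delta(G) \geq n/2 - k + 1$, then $G$ contains a subdivision of $H$ as a subgraph.
   Context: All graphs are finite and simple. A subdivision of a graph $H$ is any graph obtainable from $H$ by a sequence of edge subdivisions, where subdividing an edge $uv$ means replacing it by a path $u w v$ through a new vertex $w$. Thus a subdivision of a disjoint union of cycles $C_1,\dots,C_k$ is a collection of vertex-disjoint cycles $C_1^*,\dots,C_k^*$ with $|C_i^*| \geq |C_i|$ for each $i$. "$G$ contains a subdivision of $H$" means some subgraph of $G$ is isomorphic to a subdivision of $H$. $\delta(G)$ denotes the minimum degree of $G$. -}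

module Defs where

open import Data.Nat using (ℕ; zero; suc; _+_; _*_; _≤_)
open import Data.Bool using (Bool; true; false; not)
open import Data.Fin using (Fin; zero; suc; inject₁; fromℕ)
open import Data.Vec using (Vec; lookup)
open import Data.Product using (Σ; _×_)
open import Relation.Binary.PropositionalEquality using (_≡_; _≢_)
open import Function.Definitions using (Injective)

countF : ∀ {m} → (Fin m → Bool) → ℕ
countF {zero} p = 0
countF {suc m} p with p zero
... | true  = suc (countF (λ i → p (suc i)))
... | false = countF (λ i → p (suc i))

record Graph (m : ℕ) : Set where
  field
    adj   : Fin m → Fin m → Bool
    sym   : ∀ u v → adj u v ≡ adj v u
    irrefl : ∀ v → adj v v ≡ false

open Graph public

degree : ∀ {m} → Graph m → Fin m → ℕ
degree G v = countF (adj G v)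

minDegree≥ : ∀ {m} → Graph m → ℕ → Set
minDegree≥ G d = ∀ v → d ≤ degree G v

-- (X , Y) bipartition: X = vertices with side true, Y = side false
IsBipartition : ∀ {m} → Graph m → (Fin m → Bool) → Set
IsBipartition G side = ∀ u v → adj G u v ≡ true → side u ≢ side v

record Cycle {m} (G : Graph m) (len : ℕ) : Set where
  field
    p      : ℕ
    len≡   : len ≡ suc p
    len≥3  : 3 ≤ len
    vs     : Fin (suc p) → Fin m
    inj    : Injective _≡_ _≡_ vs
    step   : ∀ (i : Fin p) → adj G (vs (inject₁ i)) (vs (suc i)) ≡ true
    close  : adj G (vs (fromℕ p)) (vs zero) ≡ true

open Cycle public

-- G contains a subdivision of the disjoint union of cycles of lengths cs:
-- vertex-disjoint cycles C*_j in G with |C*_j| ≥ cs_j.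
ContainsSubdivCycles : ∀ {m k} → Graph m → Vec ℕ k → Set
ContainsSubdivCycles {m} {k} G cs =
  Σ (Fin k → ℕ) λ len →
  Σ ((j : Fin k) → Cycle G (len j)) λ C →
    (∀ j → lookup cs j ≤ len j) ×
    (∀ j j' (i : Fin (suc (p (C j)))) (i' : Fin (suc (p (C j')))) →
       vs (C j) i ≡ vs (C j') i' → j ≡ j')

-- Let 2 (α_j + 1) be the prescribed lengths.  Remove the edges missing from G one at a time from the complete bipartite
-- graph: each time at most one cycle is lost, so it is enough to repair a system of k - 1 cycles whose
-- complement R has at least 2 (β + 1) vertices, β belonging to the lost cycle.  Assume that this fails.
-- Choose the cycles with as few vertices as possible.  Then a vertex of R has at most α_j + 1 neighbours
-- on C_j, with equality only if |C_j| = 2 (α_j + 1), and then it can replace any vertex of its side on C_j.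
-- Such exchanges give first a perfect matching of R and then a path P in R, with the rest of R matched,
-- on at least 2 (β + 1) vertices.  Take P = u p … w v longest.  Its ends have few neighbours in R, hence
-- together they are almost complete to some C_i, and exchanging u for x, or v for y, on C_i gives the
-- longest paths p … w v x and y u p … w.  So u, v, x, p, y, w are all ends of longest paths and have at
-- least Σ α_j + 1 neighbours on the cycles.  But on C_j with j ≠ i these six vertices have together at
-- most 6 α_j neighbours, and on C_i at most 6 α_i + 5.
module Submission where

open import Defs
open import Data.Nat using (ℕ; zero; suc; _+_; _*_; _≤_; _<_; _≤ᵇ_; z≤n; s≤s; ⌊_/2⌋)
open import Data.Nat.Properties
open import Data.Nat.Divisibility using (_∣_; divides)
open import Data.Nat.ListAction using () renaming (sum to sumᴸ)
open import Data.Nat.ListAction.Properties using (sum-↭)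
open import Data.Nat.Tactic.RingSolver using (solve; solve-∀)
open import Data.Bool using (Bool; true; false; not; _∧_; _∨_; _xor_; T)
import Data.Bool.Properties as Bool
open import Data.Vec using (Vec; sum; lookup)
open import Data.Fin using (Fin; zero; suc; inject₁; fromℕ)
import Data.Fin.Properties as Fin
open import Data.List using (List; []; _∷_; _++_; length; reverse; map; tabulate; allFin; cartesianProduct) renaming (lookup to lookupᴸ)
open import Data.List.Properties using (++-assoc; ++-identityʳ; unfold-reverse; length-++; length-reverse; ∷-injectiveˡ; ∷-injectiveʳ)
open import Data.List.Membership.Propositional using (_∈_)
open import Data.List.Membership.Propositional.Properties using (∈-allFin; ∈-cartesianProduct⁺)
open import Data.List.Relation.Binary.Permutation.Propositional using (_↭_; ↭-sym; ↭-refl; refl; prep; swap; trans)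
open import Data.List.Relation.Binary.Permutation.Propositional.Properties using (All-resp-↭; map⁺; ↭-map-inv)
open import Data.Product using (∃; _×_; _,_; proj₁; proj₂)
open import Data.Sum using (_⊎_; inj₁; inj₂)
open import Data.Empty using (⊥; ⊥-elim)
open import Data.Unit using (tt)
open import Relation.Nullary using (Dec; ¬_; yes; no; does)
open import Relation.Nullary.Decidable using (map′; _×-dec_; _⊎-dec_; dec-true)
open import Relation.Binary.PropositionalEquality using (_≡_; _≢_; refl; cong; cong₂; subst; subst₂; module ≡-Reasoning) renaming (sym to ≡-sym; trans to ≡-trans)
open import Function using (_∘_; id)

-- In these terms the degree hypothesis says that every degree is at least Σ α_j + 1, summed over
-- all k cycles. Why six vertices: the two ends of one path exceed Σ α_j over the remaining cycles
-- by 2, and a single C_i can absorb that, because a vertex may have α_i + 1 neighbours there. The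
-- exchanges produce further ends, until the excess outgrows what C_i absorbs. The bounds on a C_j
-- come from forbidden patterns on at most four consecutive vertices; the local inequality is summed
-- around the cycle. For the six vertices this gives 9 (α + 1) / 2, which is at most 6 α only from α
-- = 3 on, so the hexagon, α = 2, needs a check of all neighbourhoods. Extremal choices are not made
-- outright: each is an induction on a bound, and the statements in between refute the absence of
-- anything better. The argument thus yields a double negation, which the decidability of the
-- conclusion removes. Disjointness is carried by sums: the cycles and R partition the vertices when
-- every weight has the right total.

-- Derives g ≤ h from a nonnegative combination l ≤ r of the hypotheses, with slack k.
by : ∀ {l r g h} k → l ≤ r → g + r + k ≡ h + l → g ≤ h
by {l} {r} {g} {h} k l≤r e =
  +-cancelʳ-≤ l g h (≤-trans (+-monoʳ-≤ g l≤r) (≤-trans (m≤m+n (g + r) k) (≤-reflexive e)))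

infixl 6 _⊹_
infixr 7 _⋆_

_⊹_ : ∀ {a b c d} → a ≤ b → c ≤ d → a + c ≤ b + d
_⊹_ = +-mono-≤

_⋆_ : ∀ {a b} n → a ≤ b → n * a ≤ n * b
n ⋆ l = *-monoʳ-≤ n l

+-interchange : ∀ a b c d → a + b + (c + d) ≡ a + c + (b + d)
+-interchange = solve-∀

+-left-comm : ∀ a b c → a + (b + c) ≡ b + (a + c)
+-left-comm = solve-∀

b2n : Bool → ℕ
b2n true  = 1
b2n false = 0

b2n≤1 : ∀ b → b2n b ≤ 1
b2n≤1 true  = ≤-refl
b2n≤1 false = z≤n

-- Linear arithmetic of the counting steps

exact-arith : ∀ x y α → suc (2 * α) ≤ x + y → x ≤ α → y ≤ α → 1 ≤ 0
exact-arith x y α h h₁ h₂ = by 0 (h ⊹ h₁ ⊹ h₂) (solve (x ∷ y ∷ α ∷ []))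

heavy-arith : ∀ β s x y a b → s + suc β ≤ x + a → s + suc β ≤ y + b → a + b ≤ suc (2 * β) → suc (2 * s) ≤ x + y
heavy-arith β s x y a b h₁ h₂ h₃ = by 0 (h₁ ⊹ h₂ ⊹ h₃) (solve (β ∷ s ∷ x ∷ y ∷ a ∷ b ∷ []))

half-< : ∀ x ℓ β → 2 * x ≤ ℓ → ℓ < 2 * suc β → x ≤ β
half-< x ℓ β h k = ≤-pred (*-cancelˡ-< 2 x (suc β) (≤-<-trans h k))

second-arith : ∀ x b q lb lq ℓ → x ≡ b → 2 * b ≤ lb → 2 * q ≤ lq → lq + lb ≤ ℓ → 2 * (x + q) ≤ ℓ
second-arith x b q lb lq ℓ refl h₁ h₂ h₃ = by 0 (h₁ ⊹ h₂ ⊹ h₃) (solve (b ∷ q ∷ lb ∷ lq ∷ ℓ ∷ []))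

rest-arith : ∀ β a dg b dv k l → a ≤ 1 → b ≡ 0 → k + dg ≤ β → l + dv ≤ β → a + dg + (b + dv) ≤ suc (2 * β)
rest-arith β a dg b dv k l h₁ refl h₃ h₄ = by (k + l) (h₁ ⊹ h₃ ⊹ h₄) (solve (β ∷ a ∷ dg ∷ dv ∷ k ∷ l ∷ []))

one-arith : ∀ u p v o l {z} → z ≡ 0 → u + (p + v) + u + z ≤ 3 * o → 2 * o ≤ l → 2 * (2 * u + p + v) ≤ 3 * l
one-arith u p v o l refl h k = by 0 (2 ⋆ h ⊹ 3 ⋆ k) (solve (u ∷ p ∷ v ∷ o ∷ l ∷ []))

two-arith : ∀ x o l → x ≤ 3 * o → 2 * o ≤ l → 2 * x ≤ 3 * l
two-arith x o l h k = by 0 (2 ⋆ h ⊹ 3 ⋆ k) (solve (x ∷ o ∷ l ∷ []))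

-- The six inequalities are taken 1, 1, 3, 3, 2 and 2 times, so that each of the six unknowns occurs
-- with coefficient 16. The right-hand sides add up to 72 (α + 1), which is at most 96 α exactly
-- when α ≥ 3.
large-arith : ∀ u v p w x y α l → l ≡ 2 * suc α → 3 ≤ α →
              2 * (2 * u + p + v) ≤ 3 * l → 2 * (2 * v + w + u) ≤ 3 * l →
              2 * (2 * x + p + v) ≤ 3 * l → 2 * (2 * y + w + u) ≤ 3 * l →
              2 * (x + p + w + v) ≤ 3 * l → 2 * (y + w + p + u) ≤ 3 * l →
              u + v + p + w + x + y ≤ 6 * α
large-arith u v p w x y α l refl h a₁ a₂ b₁ b₂ c₁ c₂ = *-cancelˡ-≤ 16
  (by 0 (24 ⋆ h ⊹ a₁ ⊹ a₂ ⊹ 3 ⋆ b₁ ⊹ 3 ⋆ b₂ ⊹ 2 ⋆ c₁ ⊹ 2 ⋆ c₂) (solve (u ∷ v ∷ p ∷ w ∷ x ∷ y ∷ α ∷ [])))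

end-arith : ∀ β s x p {q} → q ≡ p → s + suc β ≤ x + q → p ≤ β → suc s ≤ x
end-arith β s x p refl h k = by 0 (h ⊹ k) (solve (β ∷ s ∷ x ∷ p ∷ []))

-- The bounds on `U + V` and `V` force `U` ≥ α + 1, so `2 * U + V` already exhausts 3 (α + 1) and
-- `P` = 0. With `q` = 0 only `k'` remains.
hub-arith : ∀ U V P α l k k' q → l ≡ 2 * suc α → P ≡ k + q → 2 * (2 * U + P + V) ≤ 3 * l →
            2 * suc α ≤ U + V → V ≤ suc α → k' ≤ 1 → k' + q ≤ 1
hub-arith U V P α l k k' q refl refl h h₁ h₂ h₃ =
  *-cancelˡ-≤ 2 (by (2 * k) (h ⊹ 4 ⋆ h₁ ⊹ 2 ⋆ h₂ ⊹ 2 ⋆ h₃) (solve (U ∷ V ∷ α ∷ k ∷ k' ∷ q ∷ [])))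

-- Six excesses of 1 stand against an allowance of 5 on one cycle.
ends-arith : ∀ {s α t cu cv cp cw cx cy u v p w x y} → α + t ≡ s →
             suc s ≤ cu + u → suc s ≤ cv + v → suc s ≤ cp + p → suc s ≤ cw + w → suc s ≤ cx + x → suc s ≤ cy + y →
             u + v + p + w + x + y ≤ 6 * t → cu + cv + cp + cw + cx + cy ≤ 5 + 6 * α → 1 ≤ 0
ends-arith {α = α} {t} {cu} {cv} {cp} {cw} {cx} {cy} {u} {v} {p} {w} {x} {y} refl h₁ h₂ h₃ h₄ h₅ h₆ h₇ h₈ =
  by 0 (h₁ ⊹ h₂ ⊹ h₃ ⊹ h₄ ⊹ h₅ ⊹ h₆ ⊹ h₇ ⊹ h₈)
    (solve (α ∷ t ∷ cu ∷ cv ∷ cp ∷ cw ∷ cx ∷ cy ∷ u ∷ v ∷ p ∷ w ∷ x ∷ y ∷ []))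

six-times : ∀ α → α + α + α + α + α + α ≡ 6 * α
six-times = solve-∀

double-suc : ∀ α → 2 * suc α ≡ suc (suc (2 * α))
double-suc = solve-∀

centre-arith₁ : ∀ u v p w x y α → u + v ≤ suc (2 * α) → p ≤ suc α → w ≤ suc α → x ≤ suc α → y ≤ suc α →
                u + v + p + w + x + y ≤ 5 + 6 * α
centre-arith₁ u v p w x y α h h₁ h₂ h₃ h₄ =
  by 0 (h ⊹ h₁ ⊹ h₂ ⊹ h₃ ⊹ h₄) (solve (u ∷ v ∷ p ∷ w ∷ x ∷ y ∷ α ∷ []))

centre-arith₂ : ∀ u v p w x y α → 2 ≤ α → u ≤ suc α → v ≤ suc α → p ≤ 1 → w ≤ suc α → x ≤ suc α → y ≤ suc α →
                u + v + p + w + x + y ≤ 5 + 6 * α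
centre-arith₂ u v p w x y α h h₀ h₁ h₂ h₃ h₄ h₅ =
  by 1 (h ⊹ h₀ ⊹ h₁ ⊹ h₂ ⊹ h₃ ⊹ h₄ ⊹ h₅) (solve (u ∷ v ∷ p ∷ w ∷ x ∷ y ∷ α ∷ []))

double-arith : ∀ {s x y} → suc s ≤ x → suc s ≤ y → suc (2 * s) ≤ x + y
double-arith {s} {x} {y} h k = by 1 (h ⊹ k) (solve (s ∷ x ∷ y ∷ []))

half-arith : ∀ a b l → l ≤ a + b → 2 * a ≤ l → l ≤ 2 * b
half-arith a b l h k = by 0 (2 ⋆ h ⊹ k) (solve (a ∷ b ∷ l ∷ []))

same-arith : ∀ a b l → a + b ≤ l → l ≤ 2 * b → a ≤ b
same-arith a b l h k = by 0 (h ⊹ k) (solve (a ∷ b ∷ l ∷ []))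

count-arith : ∀ k n l → k ≤ 1 → 2 * n ≤ l → 2 * (k + n) ≤ suc (suc l)
count-arith k n l h h' = by 0 (2 ⋆ h ⊹ h') (solve (k ∷ n ∷ l ∷ []))

twice-arith : ∀ a {b c l} → a + a + b + c ≤ l → 2 * a ≤ l
twice-arith a {b} {c} {l} h = by (b + c) h (solve (a ∷ b ∷ c ∷ l ∷ []))

swap-arith : ∀ x y q α {o} → x ≤ suc α → y ≤ suc α → suc (2 * α) ≤ x + y → 2 ≤ α →
             x + y + x + o ≤ 2 * q → 2 * q ≤ 2 * suc α → 1 ≤ 0
swap-arith x y q α {o} hx hy hs hα hw ho =
  by o (hw ⊹ ho ⊹ 2 ⋆ hs ⊹ hy ⊹ hα) (solve (x ∷ y ∷ q ∷ α ∷ o ∷ []))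

-- Not imported earlier: the variable lists given to the solver need an unambiguous _∷_.
open import Data.Vec using ([]; _∷_)
open import Data.List.Relation.Unary.All using (All; []; _∷_)
open import Data.List.Relation.Unary.All.Properties using (tabulate⁺)
open import Data.List.Relation.Unary.Any using (here; there)

-- Weighted sums over lists and over the rotations of a cycle

module ListSums {V : Set} where

  S : (V → ℕ) → List V → ℕ
  S f []      = 0
  S f (x ∷ L) = f x + S f L

  S-++ : ∀ f L L' → S f (L ++ L') ≡ S f L + S f L'
  S-++ f []      L' = refl
  S-++ f (x ∷ L) L' = ≡-trans (cong (f x +_) (S-++ f L L')) (≡-sym (+-assoc (f x) _ _))

  S-∷ʳ : ∀ f L x → S f (L ++ x ∷ []) ≡ f x + S f L
  S-∷ʳ f L x = ≡-trans (S-++ f L (x ∷ [])) (≡-trans (cong (S f L +_) (+-identityʳ (f x))) (+-comm (S f L) (f x)))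

  S-reverse : ∀ f L → S f (reverse L) ≡ S f L
  S-reverse f []      = refl
  S-reverse f (x ∷ L) =
    ≡-trans (cong (S f) (unfold-reverse x L)) (≡-trans (S-∷ʳ f (reverse L) x) (cong (f x +_) (S-reverse f L)))

  S-1 : ∀ L → S (λ _ → 1) L ≡ length L
  S-1 []      = refl
  S-1 (x ∷ L) = cong suc (S-1 L)

  S-mono : ∀ {f g} L → (∀ z → f z ≤ g z) → S f L ≤ S g L
  S-mono []      h = z≤n
  S-mono (x ∷ L) h = +-mono-≤ (h x) (S-mono L h)

  S-scale : ∀ k f L → S (λ z → k * f z) L ≡ k * S f L
  S-scale k f []      = ≡-sym (*-zeroʳ k)
  S-scale k f (x ∷ L) = ≡-trans (cong (k * f x +_) (S-scale k f L)) (≡-sym (*-distribˡ-+ k (f x) (S f L)))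

  S-+ : ∀ f g L → S (λ z → f z + g z) L ≡ S f L + S g L
  S-+ f g []      = refl
  S-+ f g (x ∷ L) = ≡-trans (cong (f x + g x +_) (S-+ f g L)) (+-interchange (f x) (g x) (S f L) (S g L))

  S-0 : ∀ L → S (λ _ → 0) L ≡ 0
  S-0 []      = refl
  S-0 (x ∷ L) = S-0 L

  -- Equality as multisets: every weight has the same sum.
  infix 4 _≈_
  _≈_ : List V → List V → Set
  L ≈ L' = ∀ f → S f L ≡ S f L'

  ≈-length : ∀ {L L'} → L ≈ L' → length L ≡ length L'
  ≈-length {L} {L'} e = ≡-trans (≡-sym (S-1 L)) (≡-trans (e (λ _ → 1)) (S-1 L'))

  rot : List V → List V
  rot []      = []
  rot (x ∷ L) = L ++ x ∷ []

  -- The sum of g over the rotations of A ++ B whose first element comes from A.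
  sumRot : (List V → ℕ) → List V → List V → ℕ
  sumRot g []      B = 0
  sumRot g (a ∷ A) B = g (a ∷ A ++ B) + sumRot g A (B ++ a ∷ [])

  at : (V → ℕ) → List V → ℕ
  at f []      = 0
  at f (x ∷ _) = f x

  sumRot-at : ∀ f A B → sumRot (at f) A B ≡ S f A
  sumRot-at f []      B = refl
  sumRot-at f (a ∷ A) B = cong (f a +_) (sumRot-at f A _)

  -- Rotating every summand drops the rotation that starts with `A` and gains the one that starts
  -- just behind `A`. For empty `B` the two agree, so the sum over all rotations is invariant.
  sumRot-rot : ∀ g A B → sumRot (g ∘ rot) A B + g (A ++ B) ≡ sumRot g A B + g (B ++ A)
  sumRot-rot g [] B = cong g (≡-sym (++-identityʳ B))
  sumRot-rot g (a ∷ A) B = begin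
    g ((A ++ B) ++ a ∷ []) + r + g (a ∷ A ++ B)      ≡⟨ cong (λ t → g t + r + g (a ∷ A ++ B)) (++-assoc A B (a ∷ [])) ⟩
    g (A ++ B ++ a ∷ []) + r + g (a ∷ A ++ B)        ≡⟨ cong (_+ g (a ∷ A ++ B)) (+-comm (g (A ++ B ++ a ∷ [])) r) ⟩
    r + g (A ++ B ++ a ∷ []) + g (a ∷ A ++ B)        ≡⟨ cong (_+ g (a ∷ A ++ B)) (sumRot-rot g A (B ++ a ∷ [])) ⟩
    s + g ((B ++ a ∷ []) ++ A) + g (a ∷ A ++ B)      ≡⟨ cong (λ t → s + g t + g (a ∷ A ++ B)) (++-assoc B (a ∷ []) A) ⟩
    s + g (B ++ a ∷ A) + g (a ∷ A ++ B)              ≡⟨ +-comm (s + g (B ++ a ∷ A)) _ ⟩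
    g (a ∷ A ++ B) + (s + g (B ++ a ∷ A))            ≡⟨ ≡-sym (+-assoc (g (a ∷ A ++ B)) s _) ⟩
    g (a ∷ A ++ B) + s + g (B ++ a ∷ A)              ∎
    where
    open ≡-Reasoning
    r = sumRot (g ∘ rot) A (B ++ a ∷ [])
    s = sumRot g A (B ++ a ∷ [])

  sumRot-shift : ∀ g L → sumRot (g ∘ rot) L [] ≡ sumRot g L []
  sumRot-shift g L = +-cancelʳ-≡ (g L) _ _
    (≡-trans (cong (λ t → sumRot (g ∘ rot) L [] + g t) (≡-sym (++-identityʳ L))) (sumRot-rot g L []))

  sumRot-+ : ∀ g h A B → sumRot (λ l → g l + h l) A B ≡ sumRot g A B + sumRot h A B
  sumRot-+ g h []      B = refl
  sumRot-+ g h (a ∷ A) B =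
    ≡-trans (cong (g (a ∷ A ++ B) + h (a ∷ A ++ B) +_) (sumRot-+ g h A (B ++ a ∷ [])))
          (+-interchange (g (a ∷ A ++ B)) (h (a ∷ A ++ B)) (sumRot g A (B ++ a ∷ [])) (sumRot h A (B ++ a ∷ [])))

  window : (f₁ f₂ f₃ f₄ : V → ℕ) → List V → ℕ
  window f₁ f₂ f₃ f₄ l = at f₁ l + (at f₂ ∘ rot) l + (at f₃ ∘ rot ∘ rot) l + (at f₄ ∘ rot ∘ rot ∘ rot) l

  sumRot-window : ∀ f₁ f₂ f₃ f₄ L → sumRot (window f₁ f₂ f₃ f₄) L [] ≡ S f₁ L + S f₂ L + S f₃ L + S f₄ L
  sumRot-window f₁ f₂ f₃ f₄ L =
    ≡-trans (sumRot-+ (λ l → at f₁ l + (at f₂ ∘ rot) l + (at f₃ ∘ rot ∘ rot) l) (at f₄ ∘ rot ∘ rot ∘ rot) L [])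
    (cong₂ _+_ (≡-trans (sumRot-+ (λ l → at f₁ l + (at f₂ ∘ rot) l) (at f₃ ∘ rot ∘ rot) L [])
      (cong₂ _+_ (≡-trans (sumRot-+ (at f₁) (at f₂ ∘ rot) L [])
        (cong₂ _+_ (sumRot-at f₁ L []) (one f₂)))
        (≡-trans (sumRot-shift (at f₃ ∘ rot) L) (one f₃))))
      (≡-trans (sumRot-shift (at f₄ ∘ rot ∘ rot) L) (≡-trans (sumRot-shift (at f₄ ∘ rot) L) (one f₄))))
    where
    one : ∀ f → sumRot (at f ∘ rot) L [] ≡ S f L
    one f = ≡-trans (sumRot-shift (at f) L) (sumRot-at f L [])

≢-≢⇒≡ : ∀ {a b c : Bool} → a ≢ b → b ≢ c → a ≡ c
≢-≢⇒≡ {false} {b}     {false} p q = refl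
≢-≢⇒≡ {true}  {b}     {true}  p q = refl
≢-≢⇒≡ {false} {false} {true}  p q = ⊥-elim (p refl)
≢-≢⇒≡ {false} {true}  {true}  p q = ⊥-elim (q refl)
≢-≢⇒≡ {true}  {true}  {false} p q = ⊥-elim (p refl)
≢-≢⇒≡ {true}  {false} {false} p q = ⊥-elim (q refl)

-- Paths, matchings and cycles in a bipartite graph

module Paths {V : Set} (side : V → Bool) (adj : V → V → Bool)
             (adj-sym : ∀ u v → adj u v ≡ adj v u)
             (bip : ∀ {u v} → adj u v ≡ true → side u ≢ side v) where

  open ListSums {V} public

  infix 4 _~_
  _~_ : V → V → Set
  u ~ v = adj u v ≡ true

  ~-sym : ∀ {u v} → u ~ v → v ~ u
  ~-sym {u} {v} e = ≡-trans (adj-sym v u) e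

  nb opp : V → V → ℕ
  nb u z  = b2n (adj u z)
  opp u z = b2n (side u xor side z)

  nb-no : ∀ {u z} → side u ≡ side z → nb u z ≡ 0
  nb-no {u} {z} e with adj u z in eq
  ... | true  = ⊥-elim (bip eq e)
  ... | false = refl

  nb≤1 : ∀ u z → nb u z ≤ 1
  nb≤1 u z = b2n≤1 (adj u z)

  xor-≢ : ∀ {a b} → a ≢ b → b2n (a xor b) ≡ 1
  xor-≢ {false} {false} h = ⊥-elim (h refl)
  xor-≢ {false} {true}  h = refl
  xor-≢ {true}  {false} h = refl
  xor-≢ {true}  {true}  h = ⊥-elim (h refl)

  xor-≡ : ∀ {a b} → a ≡ b → b2n (a xor b) ≡ 0
  xor-≡ {false} refl = refl
  xor-≡ {true}  refl = refl

  side-cases : ∀ u z → side u ≡ side z ⊎ side u ≢ side z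
  side-cases u z with side u Bool.≟ side z
  ... | yes e = inj₁ e
  ... | no ne = inj₂ ne

  nb≤opp : ∀ u z → nb u z ≤ opp u z
  nb≤opp u z with adj u z in eq
  ... | true  = ≤-reflexive (≡-sym (xor-≢ (bip eq)))
  ... | false = z≤n

  opp-~ : ∀ r {y z} → y ~ z → opp r y + opp r z ≡ 1
  opp-~ r {y} {z} e with side-cases r y
  ... | inj₁ s  = cong₂ _+_ (xor-≡ s) (xor-≢ (λ t → bip e (≡-trans (≡-sym s) t)))
  ... | inj₂ ns = cong₂ _+_ (xor-≢ ns) (xor-≡ (≢-≢⇒≡ ns (bip e)))

  d : V → List V → ℕ
  d u = S (nb u)

  -- Vertices may repeat in the list; that they do not is a consequence of the weight sums, once a
  -- path or cycle is part of a partition of the vertex set.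
  data Path : V → List V → V → Set where
    [_] : ∀ a → Path a (a ∷ []) a
    _∷_ : ∀ {a b c L} → a ~ b → Path b L c → Path a (a ∷ L) c

  path-++ : ∀ {a b c e L M} → Path a L b → b ~ c → Path c M e → Path a (L ++ M) e
  path-++ [ a ]   e Q = e ∷ Q
  path-++ (x ∷ P) e Q = x ∷ path-++ P e Q

  path-∷ʳ : ∀ {a b c L} → Path a L b → b ~ c → Path a (L ++ c ∷ []) c
  path-∷ʳ P e = path-++ P e [ _ ]

  path-reverse : ∀ {a b L} → Path a L b → Path b (reverse L) a
  path-reverse [ a ] = [ a ]
  path-reverse {a} {b} (_∷_ {L = L} x P) =
    subst (λ l → Path b l a) (≡-sym (unfold-reverse a L)) (path-∷ʳ (path-reverse P) (~-sym x))

  -- What is left of a path, cut at an edge into its end c.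
  data Front (a : V) : List V → V → Set where
    []  : ∀ {c} → Front a [] c
    cut : ∀ {L b c} → Path a L b → b ~ c → Front a L c

  last-nbr : ∀ {a L b} r → Path a L b → 1 ≤ d r L →
             ∃ λ A → ∃ λ B → ∃ λ e → L ≡ A ++ B × Path a A e × r ~ e × d r B ≡ 0
  last-nbr r [ a ] h with adj r a in eq
  ... | true  = a ∷ [] , [] , a , refl , [ a ] , eq , refl
  last-nbr r [ a ] () | false
  last-nbr r (_∷_ {a} {L = L} x P) h with d r L in eq
  ... | suc _ with last-nbr r P (subst (1 ≤_) (≡-sym eq) (s≤s z≤n))
  ...   | A , B , e , refl , PA , re , z = a ∷ A , B , e , refl , x ∷ PA , re , z
  last-nbr r (_∷_ {a} {L = L} x P) h | zero with adj r a in eq'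
  ... | true = a ∷ [] , L , a , refl , [ a ] , eq' , eq
  last-nbr r (_∷_ {a} {L = L} x P) () | zero | false

  first-nbr : ∀ {a L b} r → Path a L b → 1 ≤ d r L →
              ∃ λ A → ∃ λ B → ∃ λ e → L ≡ A ++ B × Path e B b × r ~ e × d r A ≡ 0 × Front a A e
  first-nbr r [ a ] h with adj r a in eq
  ... | true  = [] , a ∷ [] , a , refl , [ a ] , eq , refl , []
  first-nbr r [ a ] () | false
  first-nbr r (_∷_ {a} {L = L} x P) h with adj r a in eq
  ... | true = [] , a ∷ L , a , refl , x ∷ P , eq , refl , []
  ... | false with first-nbr r P h
  ...   | [] , B , e , refl , PB , re , z , [] =
          a ∷ [] , B , e , refl , PB , re , ≡-trans (cong (λ t → b2n t + 0) eq) refl , cut [ a ] (edge x P PB)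
    where
    edge : ∀ {a b L c e} → a ~ b → Path b L c → Path e L c → a ~ e
    edge x [ _ ]   [ _ ]   = x
    edge x (_ ∷ _) (_ ∷ _) = x
  ...   | A , B , e , refl , PB , re , z , cut PA l =
          a ∷ A , B , e , refl , PB , re , ≡-trans (cong₂ (λ t s → b2n t + s) eq z) refl , cut (x ∷ PA) l

  path-unsnoc : ∀ {a L b} → Path a L b → ∃ λ M → L ≡ M ++ b ∷ [] × Front a M b
  path-unsnoc [ a ]             = [] , refl , []
  path-unsnoc (_∷_ {a} x [ b ]) = a ∷ [] , refl , cut [ a ] x
  path-unsnoc (_∷_ {a} x P@(_ ∷ P')) with path-unsnoc P
  ... | M , eq , cut PM e   = a ∷ M , cong (a ∷_) eq , cut (x ∷ PM) e
  ... | [] , refl , []      with () ← P'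

  -- Sides alternate along a path and the neighbours of `r` occupy only one of them. A path that
  -- starts on the side of `r` begins with a non-neighbour, which saves the extra 1.
  count-path  : ∀ {a L b} r → Path a L b → 2 * d r L ≤ suc (length L)
  count-path′ : ∀ {a L b} r → Path a L b → side r ≡ side a → 2 * d r L ≤ length L

  count-path r [ a ] = *-monoʳ-≤ 2 (≤-trans (≤-reflexive (+-identityʳ _)) (nb≤1 r a))
  count-path r (_∷_ {a} {b} {L = L} x P) with side-cases r a
  ... | inj₁ s  rewrite nb-no {r} {a} s = m≤n⇒m≤1+n (count-path r P)
  ... | inj₂ ns = count-arith (nb r a) (d r L) (length L) (nb≤1 r a) (count-path′ r P (≢-≢⇒≡ ns (bip x)))

  count-path′ r [ a ] s rewrite nb-no {r} {a} s = z≤n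
  count-path′ r (_∷_ {a} x P) s rewrite nb-no {r} {a} s = count-path r P

  -- The order of the list carries the matching: partners stand next to each other.
  data Matched : List V → Set where
    []   : Matched []
    pair : ∀ {x y L} → x ~ y → Matched L → Matched (x ∷ y ∷ L)

  matched-++ : ∀ {L M} → Matched L → Matched M → Matched (L ++ M)
  matched-++ []         m = m
  matched-++ (pair x l) m = pair x (matched-++ l m)

  -- Ends on different sides mean an even number of vertices, so every other edge of the path is
  -- taken.
  path-matched : ∀ {a L b} → Path a L b → side a ≢ side b → Matched L
  path-matched [ a ]         ne = ⊥-elim (ne refl)
  path-matched (x ∷ [ b ])   ne = pair x []
  path-matched (x ∷ (y ∷ P)) ne = pair x (path-matched P (λ e → ne (≡-trans (≢-≢⇒≡ (bip x) (bip y)) e)))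

  front-matched : ∀ {a L c} → Front a L c → side a ≡ side c → Matched L
  front-matched []        s = []
  front-matched (cut P e) s = path-matched P (λ t → bip e (≡-trans (≡-sym t) s))

  matched-nbr : ∀ {L} u → Matched L → 1 ≤ d u L →
                ∃ λ z → ∃ λ z' → ∃ λ M → u ~ z × z ~ z' × Matched M × L ≈ z ∷ z' ∷ M
  matched-nbr u (pair {x} {y} {L} e m) h with adj u x in ex
  ... | true  = x , y , L , ex , e , m , λ f → refl
  ... | false with adj u y in ey
  ...   | true  = y , x , L , ey , ~-sym e , m , λ f → +-left-comm (f x) (f y) (S f L)
  ...   | false with matched-nbr u m h
  ...     | z , z' , M , uz , zz' , mM , eq =
            z , z' , x ∷ y ∷ M , uz , zz' , pair e mM ,
            λ f → ≡-trans (cong (λ t → f x + (f y + t)) (eq f)) (mv (f x) (f y) (f z) (f z') (S f M))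
    where
    mv : ∀ a b c d e → a + (b + (c + (d + e))) ≡ c + (d + (a + (b + e)))
    mv = solve-∀

  -- A single edge run through twice counts as well; the length bounds stated alongside exclude it.
  Cyc : List V → Set
  Cyc L = ∃ λ a → ∃ λ b → Path a L b × b ~ a

  cyc-rot : ∀ {x L} → Cyc (x ∷ L) → Cyc (L ++ x ∷ [])
  cyc-rot (_ , _ , [ a ] , e)   = a , a , [ a ] , e
  cyc-rot (a , b , x ∷ P , e) = _ , a , path-∷ʳ P e , x

  cyc-edge : ∀ {x y L} → Cyc (x ∷ y ∷ L) → x ~ y
  cyc-edge (_ , _ , x ∷ [ _ ] , _)   = x
  cyc-edge (_ , _ , x ∷ (_ ∷ _) , _) = x

  sumRot-mono : ∀ {g h : List V → ℕ} A B → Cyc (A ++ B) →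
                (∀ l → Cyc l → l ≈ A ++ B → g l ≤ h l) → sumRot g A B ≤ sumRot h A B
  sumRot-mono []      B c k = z≤n
  sumRot-mono (a ∷ A) B c k = +-mono-≤ (k _ c (λ f → refl))
    (sumRot-mono A (B ++ a ∷ []) (subst Cyc (++-assoc A B _) (cyc-rot c))
      λ l cl e → k l cl λ f → ≡-trans (e f) (≡-trans (cong (S f) (≡-sym (++-assoc A B _))) (S-∷ʳ f (A ++ B) a)))

  -- Summed over all rotations, each of the four positions runs through the whole cycle, so a local
  -- inequality becomes one between cycle sums. The right-hand side is read at `z₂`, which allows a
  -- bound that depends on the side of `z₂`.
  window-≤ : ∀ {C} → Cyc C → 4 ≤ length C → ∀ f₁ f₂ f₃ f₄ h →
             (∀ z₁ z₂ z₃ z₄ L → Cyc (z₁ ∷ z₂ ∷ z₃ ∷ z₄ ∷ L) → z₁ ∷ z₂ ∷ z₃ ∷ z₄ ∷ L ≈ C →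
                f₁ z₁ + f₂ z₂ + f₃ z₃ + f₄ z₄ ≤ h z₂) →
             S f₁ C + S f₂ C + S f₃ C + S f₄ C ≤ S h C
  window-≤ {C} c len f₁ f₂ f₃ f₄ h k = begin
    S f₁ C + S f₂ C + S f₃ C + S f₄ C  ≡⟨ ≡-sym (sumRot-window f₁ f₂ f₃ f₄ C) ⟩
    sumRot (window f₁ f₂ f₃ f₄) C []   ≤⟨ sumRot-mono C [] (subst Cyc (≡-sym (++-identityʳ C)) c)
                                             (λ l cl e → one l cl (λ f → ≡-trans (e f) (cong (S f) (++-identityʳ C)))) ⟩
    sumRot (at h ∘ rot) C []           ≡⟨ ≡-trans (sumRot-shift (at h) C) (sumRot-at h C []) ⟩
    S h C                              ∎
    where
    open ≤-Reasoning
    short : ∀ {l} → l ≈ C → ¬ (length l ≤ 3)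
    short {l} e h = <-irrefl refl (≤-trans (s≤s h) (subst (4 ≤_) (≡-sym (≈-length {l} {C} e)) len))
    one : ∀ l → Cyc l → l ≈ C → window f₁ f₂ f₃ f₄ l ≤ (at h ∘ rot) l
    one []                       cl e = z≤n
    one (_ ∷ [])                 cl e = ⊥-elim (short {_ ∷ []} e (s≤s z≤n))
    one (_ ∷ _ ∷ [])             cl e = ⊥-elim (short {_ ∷ _ ∷ []} e (s≤s (s≤s z≤n)))
    one (_ ∷ _ ∷ _ ∷ [])         cl e = ⊥-elim (short {_ ∷ _ ∷ _ ∷ []} e ≤-refl)
    one (z₁ ∷ z₂ ∷ z₃ ∷ z₄ ∷ L)  cl e = k z₁ z₂ z₃ z₄ L cl e

  -- Adding the hypothesis over all edges of the cycle counts every vertex twice.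
  cyc-half : ∀ {C} χ → (∀ {y z} → y ~ z → χ y + χ z ≤ 1) → Cyc C → 4 ≤ length C → 2 * S χ C ≤ length C
  cyc-half {C} χ χ≤ c len = twice-arith (S χ C)
    (subst (S χ C + S χ C + S (λ _ → 0) C + S (λ _ → 0) C ≤_) (S-1 C)
      (window-≤ c len χ χ (λ _ → 0) (λ _ → 0) (λ _ → 1)
        λ z₁ z₂ z₃ z₄ L cl e →
          subst (_≤ 1) (≡-sym (≡-trans (+-identityʳ _) (+-identityʳ _))) (χ≤ (cyc-edge cl))))

  half≤ : ∀ {C} r → Cyc C → 4 ≤ length C → 2 * S (opp r) C ≤ length C
  half≤ r = cyc-half (opp r) (≤-reflexive ∘ opp-~ r)

  same : V → V → ℕ
  same r z = b2n (not (side r xor side z))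

  same-opp : ∀ r L → S (same r) L + S (opp r) L ≡ length L
  same-opp r []      = refl
  same-opp r (x ∷ L) = ≡-trans (+-interchange (same r x) (S (same r) L) (opp r x) (S (opp r) L))
                             (cong₂ _+_ (one (side r xor side x)) (same-opp r L))
    where
    one : ∀ b → b2n (not b) + b2n b ≡ 1
    one false = refl
    one true  = refl

  same-~ : ∀ r {y z} → y ~ z → same r y + same r z ≡ 1
  same-~ r {y} {z} e = flip (side r xor side y) (side r xor side z) (opp-~ r e)
    where
    flip : ∀ b c → b2n b + b2n c ≡ 1 → b2n (not b) + b2n (not c) ≡ 1
    flip false true  e = refl
    flip true  false e = refl

  -- The two sides partition the cycle and neither takes more than half of it.
  half≥ : ∀ {C} r → Cyc C → 4 ≤ length C → length C ≤ 2 * S (opp r) C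
  half≥ {C} r c len = half-arith (S (same r) C) (S (opp r) C) (length C)
    (≤-reflexive (≡-sym (same-opp r C))) (cyc-half (same r) (≤-reflexive ∘ same-~ r) c len)

  same≡opp : ∀ {C} r → Cyc C → 4 ≤ length C → S (same r) C ≡ S (opp r) C
  same≡opp {C} r c len = ≤-antisym
    (same-arith (S (same r) C) (S (opp r) C) (length C) (≤-reflexive (same-opp r C)) (half≥ r c len))
    (same-arith (S (opp r) C) (S (same r) C) (length C)
      (≤-reflexive (≡-trans (+-comm (S (opp r) C) _) (same-opp r C)))
      (half-arith (S (opp r) C) (S (same r) C) (length C)
        (≤-reflexive (≡-trans (≡-sym (same-opp r C)) (+-comm (S (same r) C) _))) (half≤ r c len)))

  find : ∀ (f : V → Bool) L → 1 ≤ S (b2n ∘ f) L → ∃ λ A → ∃ λ z → ∃ λ B → L ≡ A ++ z ∷ B × f z ≡ true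
  find f (x ∷ L) h with f x in eq
  ... | true  = [] , x , L , refl , eq
  ... | false with find f L h
  ...   | A , z , B , refl , e = x ∷ A , z , B , refl , e

  d≤half : ∀ {C} r → Cyc C → 4 ≤ length C → 2 * d r C ≤ length C
  d≤half {C} r c len = ≤-trans (2 ⋆ S-mono C (nb≤opp r)) (half≤ r c len)

  path-edge : ∀ {a b L c} → Path a (a ∷ b ∷ L) c → a ~ b
  path-edge (x ∷ [ _ ])   = x
  path-edge (x ∷ (_ ∷ _)) = x

  path-start : ∀ {a x L b} → Path a (x ∷ L) b → Path x (x ∷ L) b
  path-start [ _ ]   = [ _ ]
  path-start (e ∷ P) = e ∷ P

  cyc-edge₂ : ∀ {x y z L} → Cyc (x ∷ y ∷ z ∷ L) → y ~ z
  cyc-edge₂ (_ , _ , _ ∷ P@(_ ∷ _) , _) = path-edge P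

  cyc-edge₃ : ∀ {x y z w L} → Cyc (x ∷ y ∷ z ∷ w ∷ L) → z ~ w
  cyc-edge₃ (_ , _ , _ ∷ (_ ∷ P@(_ ∷ _)) , _) = path-edge P

  -- The stretch from the first to the last neighbour of `r` closes up through `r`. It keeps all
  -- neighbours of `r` on the path, so the cycle has at least twice as many vertices; `D` collects
  -- what is cut off.
  nbr-span : ∀ {a L b} r → Path a L b → 1 ≤ d r L →
             ∃ λ M → ∃ λ D → Cyc (r ∷ M) × D ++ M ≈ L × 2 * d r L ≤ length (r ∷ M)
  nbr-span r P h with last-nbr r P h
  ... | A , B , f , refl , PA , rf , zB
    with first-nbr r PA (subst (1 ≤_) (≡-trans (S-++ (nb r) A B) (≡-trans (cong (d r A +_) zB) (+-identityʳ _))) h)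
  ... | A' , M , g , refl , PM , rg , zA' , _ =
    M , A' ++ B , (r , f , rg ∷ PM , ~-sym rf) , eq ,
    subst (λ t → 2 * t ≤ suc (length M)) (≡-sym dM) (count-path r PM)
    where
    mv : ∀ a b c → a + b + c ≡ a + c + b
    mv = solve-∀
    split : ∀ f → S f ((A' ++ M) ++ B) ≡ S f A' + S f M + S f B
    split f = ≡-trans (S-++ f (A' ++ M) B) (cong (_+ S f B) (S-++ f A' M))
    eq : (A' ++ B) ++ M ≈ (A' ++ M) ++ B
    eq f = ≡-trans (≡-trans (S-++ f (A' ++ B) M) (cong (_+ S f M) (S-++ f A' B)))
                 (≡-trans (mv (S f A') (S f B) (S f M)) (≡-sym (split f)))
    dM : d r ((A' ++ M) ++ B) ≡ d r M
    dM = ≡-trans (split (nb r)) (≡-trans (cong₂ (λ s t → s + d r M + t) zA' zB) (+-identityʳ _))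

  -- An arc of `C` that keeps `a` neighbours of `r` contains, by `nbr-span`, all but one vertex of a
  -- cycle through `r` of length at least `2 * a`. As `C` is too long for its bound, such an arc
  -- must exist.
  shorten : ∀ {C a} r → Cyc C → 1 ≤ a → 4 ≤ length C → a ≤ d r C → 2 * a < length C →
            (∀ M D → Cyc (r ∷ M) → D ++ M ≈ C → 2 * a ≤ length (r ∷ M) → length (r ∷ M) < length C → ⊥) → ⊥
  shorten {C} {a} r c 1≤a len a≤d 2a<l k = <-irrefl refl (≤-trans 1≤a (≤-trans a≤d d≤0))
    where
    -- Three vertices go and only `r` comes in, so an arc that keeps `a` neighbours would give a
    -- shorter cycle.
    arc : ∀ z₁ z₂ z₃ z₄ L → Cyc (z₁ ∷ z₂ ∷ z₃ ∷ z₄ ∷ L) → z₁ ∷ z₂ ∷ z₃ ∷ z₄ ∷ L ≈ C → ¬ (a ≤ d r (z₄ ∷ L))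
    arc z₁ z₂ z₃ z₄ L (_ , b , _ ∷ (_ ∷ (_ ∷ P)) , _) e a≤ with nbr-span r P (≤-trans 1≤a a≤)
    ... | M , D , cM , eq , le =
      k M (z₁ ∷ z₂ ∷ z₃ ∷ D) cM (λ f → ≡-trans (cong (λ t → f z₁ + (f z₂ + (f z₃ + t))) (eq f)) (e f))
        (≤-trans (2 ⋆ a≤) le)
        (subst (suc (suc (length M)) ≤_) (≈-length {z₁ ∷ z₂ ∷ z₃ ∷ D ++ M} {C} all≈)
          (s≤s (s≤s (m≤n⇒m≤1+n (subst (length M ≤_) (≡-sym (length-++ D)) (m≤n+m (length M) (length D)))))))
      where
      all≈ : z₁ ∷ z₂ ∷ z₃ ∷ D ++ M ≈ C
      all≈ f = ≡-trans (cong (λ t → f z₁ + (f z₂ + (f z₃ + t))) (eq f)) (e f)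
    zeros : ∀ {z₁ z₂ z₃ z₄ L} → Cyc (z₁ ∷ z₂ ∷ z₃ ∷ z₄ ∷ L) → z₁ ∷ z₂ ∷ z₃ ∷ z₄ ∷ L ≈ C →
            side r ≢ side z₂ → nb r z₂ + d r (z₄ ∷ L) ≡ d r C
    zeros {z₁} {z₂} {z₃} {z₄} {L} cl e ne = ≡-trans
      (cong₂ (λ s t → s + (nb r z₂ + (t + d r (z₄ ∷ L))))
        (≡-sym (nb-no {r} {z₁} (≢-≢⇒≡ ne (bip (~-sym (cyc-edge cl))))))
        (≡-sym (nb-no {r} {z₃} (≢-≢⇒≡ ne (bip (cyc-edge₂ cl))))))
      (e (nb r))
    -- A non-neighbour `z₂` on the other side could be dropped together with `z₁` and `z₃`, which
    -- lie on the side of `r`, without losing any neighbour. Hence `r` is adjacent to the whole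
    -- other side of `C`.
    opp≤d : S (opp r) C ≤ d r C
    opp≤d = arith (window-≤ c len (λ _ → 0) (opp r) (λ _ → 0) (λ _ → 0) (nb r) win)
      where
      arith : ∀ {x} → S (λ _ → 0) C + S (opp r) C + S (λ _ → 0) C + S (λ _ → 0) C ≤ x → S (opp r) C ≤ x
      arith {x} h rewrite S-0 C | +-identityʳ (S (opp r) C) | +-identityʳ (S (opp r) C) = h
      win : ∀ z₁ z₂ z₃ z₄ L → Cyc (z₁ ∷ z₂ ∷ z₃ ∷ z₄ ∷ L) → z₁ ∷ z₂ ∷ z₃ ∷ z₄ ∷ L ≈ C →
            opp r z₂ + 0 + 0 ≤ nb r z₂
      win z₁ z₂ z₃ z₄ L cl e rewrite +-identityʳ (opp r z₂) | +-identityʳ (opp r z₂) with side-cases r z₂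
      ... | inj₁ s rewrite xor-≡ s = z≤n
      ... | inj₂ ns with adj r z₂ in eq
      ...   | true  rewrite xor-≢ ns = ≤-refl
      ...   | false = ⊥-elim (arc z₁ z₂ z₃ z₄ L cl e
                        (≤-trans a≤d (≤-reflexive (≡-trans (≡-sym (zeros cl e ns)) (cong (λ t → b2n t + d r (z₄ ∷ L)) eq)))))
    a<d : a < d r C
    a<d = *-cancelˡ-< 2 a (d r C) (≤-trans 2a<l (≤-trans (half≥ r c len) (2 ⋆ opp≤d)))
    -- Now even an arc that loses a neighbour keeps `a` of them, so there can be no neighbour at
    -- all.
    d≤0 : d r C ≤ 0
    d≤0 = arith (window-≤ c len (λ _ → 0) (nb r) (λ _ → 0) (λ _ → 0) (λ _ → 0) win)
      where
      arith : S (λ _ → 0) C + d r C + S (λ _ → 0) C + S (λ _ → 0) C ≤ S (λ _ → 0) C → d r C ≤ 0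
      arith h rewrite S-0 C | +-identityʳ (d r C) | +-identityʳ (d r C) = h
      win : ∀ z₁ z₂ z₃ z₄ L → Cyc (z₁ ∷ z₂ ∷ z₃ ∷ z₄ ∷ L) → z₁ ∷ z₂ ∷ z₃ ∷ z₄ ∷ L ≈ C →
            nb r z₂ + 0 + 0 ≤ 0
      win z₁ z₂ z₃ z₄ L cl e rewrite +-identityʳ (nb r z₂) | +-identityʳ (nb r z₂) with adj r z₂ in eq
      ... | false = z≤n
      ... | true  = ⊥-elim (arc z₁ z₂ z₃ z₄ L cl e
                      (≤-pred (≤-trans a<d (≤-reflexive (≡-trans (≡-sym (zeros cl e (bip eq))) (cong (λ t → b2n t + d r (z₄ ∷ L)) eq))))))

  -- The vertex sought is a neighbour `z` of `t` whose two neighbours on `C` are adjacent to `r`.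
  -- Without one, at most two of these three adjacencies hold at each vertex opposite to `t`, so 2
  -- d(r) + d(t) ≤ 2 (α + 1) on `C`. But d(t) ≤ α + 1 gives d(r) ≥ α and a left-hand side of at
  -- least 3 α + 1, which is too much for α ≥ 2.
  find-swap : ∀ {C α} r t → side r ≢ side t → Cyc C → length C ≡ 2 * suc α → 2 ≤ α →
              d r C ≤ suc α → d t C ≤ suc α → suc (2 * α) ≤ d r C + d t C →
              (∀ z L a b → C ≈ z ∷ L → Path a L b → r ~ a → b ~ r → t ~ z → ⊥) → ⊥
  find-swap {C} {α} r t ne c len 2≤α dr dt h k =
    <-irrefl refl (swap-arith (d r C) (d t C) (S (opp t) C) α dr dt h 2≤α (subst (d r C + d t C + d r C + S (λ _ → 0) C ≤_) (S-scale 2 (opp t) C) sums) (subst (2 * S (opp t) C ≤_) len (half≤ t c len4)))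
    where
    len4 : 4 ≤ length C
    len4 = ≤-trans (s≤s (s≤s (s≤s (s≤s z≤n)))) (subst (6 ≤_) (≡-sym len) (2 ⋆ s≤s 2≤α))
    sums : d r C + d t C + d r C + S (λ _ → 0) C ≤ S (λ z → 2 * opp t z) C
    sums = window-≤ c len4 (nb r) (nb t) (nb r) (λ _ → 0) (λ z → 2 * opp t z) win
      where
      win : ∀ z₁ z₂ z₃ z₄ L → Cyc (z₁ ∷ z₂ ∷ z₃ ∷ z₄ ∷ L) → z₁ ∷ z₂ ∷ z₃ ∷ z₄ ∷ L ≈ C →
            nb r z₁ + nb t z₂ + nb r z₃ + 0 ≤ 2 * opp t z₂
      win z₁ z₂ z₃ z₄ L cl e with side-cases t z₂
      ... | inj₁ s rewrite nb-no {t} {z₂} s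
                         | nb-no {r} {z₁} (≢-≢⇒≡ (λ q → ne (≡-trans q (≡-sym s))) (bip (~-sym (cyc-edge cl))))
                         | nb-no {r} {z₃} (≢-≢⇒≡ (λ q → ne (≡-trans q (≡-sym s))) (bip (cyc-edge₂ cl))) = z≤n
      ... | inj₂ ns rewrite xor-≢ ns with adj r z₁ in e₁ | adj t z₂ in e₂ | adj r z₃ in e₃
      ...   | false | false | false = z≤n
      ...   | false | false | true  = s≤s z≤n
      ...   | false | true  | false = s≤s z≤n
      ...   | false | true  | true  = ≤-refl
      ...   | true  | false | false = s≤s z≤n
      ...   | true  | false | true  = ≤-refl
      ...   | true  | true  | false = ≤-refl
      ...   | true  | true  | true  = ⊥-elim (use cl)
        where
        use : Cyc (z₁ ∷ z₂ ∷ z₃ ∷ z₄ ∷ L) → ⊥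
        use (_ , b , _ ∷ (_ ∷ P) , bz) = k z₂ ((z₃ ∷ z₄ ∷ L) ++ z₁ ∷ []) z₃ z₁
          (λ f → ≡-trans (≡-sym (e f)) (mv f)) (path-∷ʳ (path-start P) bz) e₃ (~-sym e₁) e₂
          where
          mv : ∀ f → S f (z₁ ∷ z₂ ∷ z₃ ∷ z₄ ∷ L) ≡ f z₂ + S f ((z₃ ∷ z₄ ∷ L) ++ z₁ ∷ [])
          mv f = ≡-trans (+-left-comm (f z₁) (f z₂) _) (cong (f z₂ +_) (≡-sym (S-∷ʳ f (z₃ ∷ z₄ ∷ L) z₁)))

-- Exhaustive check of six neighbourhoods on a hexagon

module Hexagon where

  record B³ : Set where
    constructor ⟨_,_,_⟩
    field a₁ a₂ a₃ : Bool
  open B³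

  both : (Bool → Bool) → Bool
  both g = g true ∧ g false

  all : (B³ → Bool) → Bool
  all f = both λ x → both λ y → both λ z → f ⟨ x , y , z ⟩

  ∧-true : ∀ {a b} → a ∧ b ≡ true → a ≡ true × b ≡ true
  ∧-true {true} {true} e = refl , refl

  all-true : ∀ f → all f ≡ true → ∀ t → f t ≡ true
  all-true f e ⟨ x , y , z ⟩ = pick (λ z → f ⟨ x , y , z ⟩) z (pick (λ y → both λ z → f ⟨ x , y , z ⟩) y
                               (pick (λ x → both λ y → both λ z → f ⟨ x , y , z ⟩) x e))
    where
    pick : ∀ g x → both g ≡ true → g x ≡ true
    pick g true  e = proj₁ (∧-true e)
    pick g false e = proj₂ (∧-true e)

  count : B³ → ℕ
  count ⟨ x , y , z ⟩ = b2n x + b2n y + b2n z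

  -- The hexagon is x₁ y₁ x₂ y₂ x₃ y₃; neighbourhoods of u, x, w consist of y's and those of v, y, p of x's.
  bad-x bad-y : B³ → B³ → B³ → Bool
  bad-x u p v = (a₃ u ∧ a₁ u ∧ a₁ p ∧ a₁ v) ∨ (a₁ u ∧ a₂ u ∧ a₂ p ∧ a₂ v) ∨ (a₂ u ∧ a₃ u ∧ a₃ p ∧ a₃ v)
  bad-y v w u = (a₁ v ∧ a₂ v ∧ a₁ w ∧ a₁ u) ∨ (a₂ v ∧ a₃ v ∧ a₂ w ∧ a₂ u) ∨ (a₃ v ∧ a₁ v ∧ a₃ w ∧ a₃ u)

  -- The three runs of four consecutive vertices that begin with a y-vertex: `x` sees the first, `p`
  -- the second, `w` the third and `v` the fourth.
  bad-xp : (x p w v : B³) → Bool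
  bad-xp x p w v = (a₃ x ∧ a₁ p ∧ a₁ w ∧ a₂ v) ∨ (a₁ x ∧ a₂ p ∧ a₂ w ∧ a₃ v) ∨ (a₂ x ∧ a₃ p ∧ a₃ w ∧ a₁ v)

  bad-yw : (y w p u : B³) → Bool
  bad-yw y w p u = (a₁ y ∧ a₁ w ∧ a₂ p ∧ a₂ u) ∨ (a₂ y ∧ a₂ w ∧ a₃ p ∧ a₃ u) ∨ (a₃ y ∧ a₃ w ∧ a₁ p ∧ a₁ u)

  -- Every exclusion is tested as soon as its vertices are chosen; this prunes the evaluation of the
  -- 8 ^ 6 combinations.
  check₆ : (u v p w x y : B³) → Bool
  check₆ u v p w x y = bad-y y w u ∨ bad-yw y w p u ∨ (count u + count v + count p + count w + count x + count y ≤ᵇ 12)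

  check₅ : (u v p w x : B³) → Bool
  check₅ u v p w x = bad-x x p v ∨ bad-xp x p w v ∨ all (check₆ u v p w x)

  -- Six neighbours of `u`, `v`, `p`, `w` together are harmless, because `x` and `y` add at most
  -- three each.
  check₄ : (u v p w : B³) → Bool
  check₄ u v p w = bad-y v w u ∨ (count u + count v + count p + count w ≤ᵇ 6) ∨ all (check₅ u v p w)

  check₃ : (u v p : B³) → Bool
  check₃ u v p = bad-x u p v ∨ all (check₄ u v p)

  check₂ : (u v : B³) → Bool
  check₂ u v = all (check₃ u v)

  checked : all (λ u → all (check₂ u)) ≡ true
  checked = refl

  six : ∀ u v p w x y → bad-x u p v ≡ false → bad-y v w u ≡ false → bad-x x p v ≡ false → bad-y y w u ≡ false →
        bad-xp x p w v ≡ false → bad-yw y w p u ≡ false →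
        count u + count v + count p + count w + count x + count y ≤ 12
  six u v p w x y h₁ h₂ h₃ h₄ h₅ h₆ = last (skip h₁ (all-true (check₃ u v) (all-true (check₂ u) (all-true (λ u → all (check₂ u)) checked u) v) p))
    where
    skip : ∀ {a b} → a ≡ false → a ∨ b ≡ true → b ≡ true
    skip refl e = e
    ≤ᵇ-true : ∀ {m n} → (m ≤ᵇ n) ≡ true → m ≤ n
    ≤ᵇ-true {m} {n} e = ≤ᵇ⇒≤ m n (subst T (≡-sym e) tt)
    count≤3 : ∀ t → count t ≤ 3
    count≤3 ⟨ a , b , c ⟩ = +-mono-≤ (+-mono-≤ (b2n≤1 a) (b2n≤1 b)) (b2n≤1 c)
    ∨-true : ∀ {a b} → a ∨ b ≡ true → a ≡ true ⊎ b ≡ true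
    ∨-true {true}  e = inj₁ e
    ∨-true {false} e = inj₂ e
    last : all (check₄ u v p) ≡ true → count u + count v + count p + count w + count x + count y ≤ 12
    last e with ∨-true (skip h₂ (all-true (check₄ u v p) e w))
    ... | inj₁ q = +-mono-≤ (+-mono-≤ (≤ᵇ-true {count u + count v + count p + count w} {6} q) (count≤3 x)) (count≤3 y)
    ... | inj₂ q = ≤ᵇ-true {count u + count v + count p + count w + count x + count y} {12} (skip h₆ (skip h₄ (all-true (check₆ u v p w x) (skip h₅ (skip h₃ (all-true (check₅ u v p w) q x))) y)))

-- Six path ends against one cycle

module SixVertices {V : Set} (side : V → Bool) (adj : V → V → Bool)
             (adj-sym : ∀ u v → adj u v ≡ adj v u)
             (bip : ∀ {u v} → adj u v ≡ true → side u ≢ side v) where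

  open Paths side adj adj-sym bip
  open Hexagon

  -- If One fails, then u replaces z₂ on C and z₂ closes a path from p to v.  If Two fails, then
  -- a e replaces z₂ z₃ on C and z₂ z₃ closes a path from c to b.
  One : List V → V → V → V → Set
  One C u p v = ∀ z₁ z₂ z₃ z₄ L → Cyc (z₁ ∷ z₂ ∷ z₃ ∷ z₄ ∷ L) → z₁ ∷ z₂ ∷ z₃ ∷ z₄ ∷ L ≈ C →
                u ~ z₁ → u ~ z₃ → p ~ z₂ → v ~ z₂ → ⊥

  Two : List V → V → V → V → V → Set
  Two C a b c e = ∀ z₁ z₂ z₃ z₄ L → Cyc (z₁ ∷ z₂ ∷ z₃ ∷ z₄ ∷ L) → z₁ ∷ z₂ ∷ z₃ ∷ z₄ ∷ L ≈ C →
                  a ~ z₁ → b ~ z₂ → c ~ z₃ → e ~ z₄ → ⊥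

  four : ∀ a b c e → (a ≡ true → b ≡ true → c ≡ true → e ≡ true → ⊥) → b2n a + b2n b + b2n c + b2n e ≤ 3
  four true true true true h = ⊥-elim (h refl refl refl refl)
  four false b c e h = +-mono-≤ (+-mono-≤ (b2n≤1 b) (b2n≤1 c)) (b2n≤1 e)
  four true false c e h = s≤s (+-mono-≤ (b2n≤1 c) (b2n≤1 e))
  four true true false e h = s≤s (s≤s (b2n≤1 e))
  four true true true false h = ≤-refl

  four-∧ : ∀ {a b c e} → (a ≡ true → b ≡ true → c ≡ true → e ≡ true → ⊥) → a ∧ b ∧ c ∧ e ≡ false
  four-∧ {true}  {true}  {true}  {true}  h = ⊥-elim (h refl refl refl refl)
  four-∧ {false} h = refl
  four-∧ {true}  {false} h = refl
  four-∧ {true}  {true}  {false} h = refl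
  four-∧ {true}  {true}  {true}  {false} h = refl

  -- At each `z₂` at most three of the four adjacencies excluded by `One` hold, and only the
  -- vertices `z₂` opposite to `p`, half of the cycle, can have any.
  one-bound : ∀ {C u p v} → Cyc C → 4 ≤ length C → side u ≢ side p → side u ≢ side v → One C u p v →
              2 * (2 * d u C + d p C + d v C) ≤ 3 * length C
  one-bound {C} {u} {p} {v} c len up uv one =
    one-arith (d u C) (d p C) (d v C) (S (opp p) C) (length C) (S-0 C)
      (subst₂ (λ s t → d u C + s + d u C + S (λ _ → 0) C ≤ t) (S-+ (nb p) (nb v) C) (S-scale 3 (opp p) C)
        (window-≤ c len (nb u) (λ z → nb p z + nb v z) (nb u) (λ _ → 0) (λ z → 3 * opp p z) win))
      (half≤ p c len)
    where
    pv : side p ≡ side v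
    pv = ≢-≢⇒≡ (up ∘ ≡-sym) uv
    win : ∀ z₁ z₂ z₃ z₄ L → Cyc (z₁ ∷ z₂ ∷ z₃ ∷ z₄ ∷ L) → z₁ ∷ z₂ ∷ z₃ ∷ z₄ ∷ L ≈ C →
          nb u z₁ + (nb p z₂ + nb v z₂) + nb u z₃ + 0 ≤ 3 * opp p z₂
    win z₁ z₂ z₃ z₄ L cl e with side-cases p z₂
    ... | inj₁ s rewrite nb-no {p} {z₂} s | nb-no {v} {z₂} (≡-trans (≡-sym pv) s)
                       | nb-no {u} {z₁} (≢-≢⇒≡ (λ q → up (≡-trans q (≡-sym s))) (bip (~-sym (cyc-edge cl))))
                       | nb-no {u} {z₃} (≢-≢⇒≡ (λ q → up (≡-trans q (≡-sym s))) (bip (cyc-edge₂ cl))) = z≤n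
    ... | inj₂ ns rewrite xor-≢ ns =
      subst (_≤ 3) (mv (nb u z₁) (nb p z₂) (nb v z₂) (nb u z₃))
        (four _ _ _ _ λ a b c e' → one z₁ z₂ z₃ z₄ L cl e a e' b c)
      where
      mv : ∀ a b c e → a + b + c + e ≡ a + (b + c) + e + 0
      mv = solve-∀

  two-bound : ∀ {C a b c e} → Cyc C → 4 ≤ length C → side a ≢ side b → side a ≡ side c → side b ≡ side e → Two C a b c e →
              2 * (d a C + d b C + d c C + d e C) ≤ 3 * length C
  two-bound {C} {a} {b} {c} {e} cy len ab ac be two =
    two-arith (d a C + d b C + d c C + d e C) (S (opp b) C) (length C)
      (subst (d a C + d b C + d c C + d e C ≤_) (S-scale 3 (opp b) C)
        (window-≤ cy len (nb a) (nb b) (nb c) (nb e) (λ z → 3 * opp b z) win))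
      (half≤ b cy len)
    where
    win : ∀ z₁ z₂ z₃ z₄ L → Cyc (z₁ ∷ z₂ ∷ z₃ ∷ z₄ ∷ L) → z₁ ∷ z₂ ∷ z₃ ∷ z₄ ∷ L ≈ C →
          nb a z₁ + nb b z₂ + nb c z₃ + nb e z₄ ≤ 3 * opp b z₂
    win z₁ z₂ z₃ z₄ L cl eq with side-cases b z₂
    ... | inj₂ ns rewrite xor-≢ ns = four _ _ _ _ (two z₁ z₂ z₃ z₄ L cl eq)
    ... | inj₁ s rewrite nb-no {b} {z₂} s
                       | nb-no {a} {z₁} (≢-≢⇒≡ (λ q → ab (≡-trans q (≡-sym s))) (bip (~-sym (cyc-edge cl))))
                       | nb-no {c} {z₃} (≢-≢⇒≡ (λ q → ab (≡-trans ac (≡-trans q (≡-sym s)))) (bip (cyc-edge₂ cl)))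
                       | nb-no {e} {z₄} (≡-trans (≡-sym be) (≡-trans s (≢-≢⇒≡ (bip (cyc-edge₂ cl)) (bip (cyc-edge₃ cl))))) = z≤n

  -- The exclusions stem from the longest paths `u p … w v`, `p … w v x` and `y u p … w`. Without
  -- one end, the rest of such a path can be closed by `z₂`; without the last two vertices `v x` or
  -- the first two `y u`, what is left is `p … w`.
  record Six (C : List V) (u v p w x y : V) : Set where
    field
      uv   : side u ≢ side v
      up   : side u ≡ side p → ⊥
      vw   : side v ≢ side w
      vx   : side v ≢ side x
      uy   : side u ≢ side y
      u-pv : One C u p v
      v-wu : One C v w u
      x-pv : One C x p v
      y-wu : One C y w u
      xpwv : Two C x p w v
      ywpu : Two C y w p u

  module _ {C u v p w x y} (σ : Six C u v p w x y) where
    open Six σ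

    edges : ℕ
    edges = d u C + d v C + d p C + d w C + d x C + d y C

    vp : side v ≡ side p
    vp = ≢-≢⇒≡ (uv ∘ ≡-sym) up

    vy : side v ≡ side y
    vy = ≢-≢⇒≡ (uv ∘ ≡-sym) uy

    uw : side u ≡ side w
    uw = ≢-≢⇒≡ uv vw

    ux : side u ≡ side x
    ux = ≢-≢⇒≡ uv vx

    large-bound : ∀ {α} → Cyc C → length C ≡ 2 * suc α → 3 ≤ α → edges ≤ 6 * α
    large-bound {α} c len 3≤α =
      large-arith (d u C) (d v C) (d p C) (d w C) (d x C) (d y C) α (length C) len 3≤α
        (one-bound c len4 up uv u-pv)
        (one-bound c len4 vw (uv ∘ ≡-sym) v-wu)
        (one-bound c len4 (λ q → up (≡-trans ux q)) (λ q → vx (≡-sym q)) x-pv)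
        (one-bound c len4 (λ q → vw (≡-trans vy q)) (λ q → uy (≡-sym q)) y-wu)
        (two-bound c len4 (λ q → up (≡-trans ux q)) (≡-trans (≡-sym ux) uw) (≡-sym vp) xpwv)
        (two-bound c len4 (λ q → vw (≡-trans vy q)) (≡-trans (≡-sym vy) vp) (≡-sym uw) ywpu)
      where
      len4 : 4 ≤ length C
      len4 = ≤-trans (≤-trans (s≤s (s≤s (s≤s (s≤s z≤n)))) (2 ⋆ s≤s 3≤α)) (≤-reflexive (≡-sym len))

    module _ {x₁ y₁ x₂ y₂ x₃ y₃} (c : Cyc (x₁ ∷ y₁ ∷ x₂ ∷ y₂ ∷ x₃ ∷ y₃ ∷ []))
             (e : x₁ ∷ y₁ ∷ x₂ ∷ y₂ ∷ x₃ ∷ y₃ ∷ [] ≈ C) (s₁ : side u ≡ side x₁) where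

      rot-≈ : ∀ {z L} → z ∷ L ≈ C → L ++ z ∷ [] ≈ C
      rot-≈ {z} {L} e f = ≡-trans (S-∷ʳ f L z) (e f)

      c₁ = cyc-rot c
      c₂ = cyc-rot c₁
      c₃ = cyc-rot c₂
      c₄ = cyc-rot c₃
      c₅ = cyc-rot c₄
      e₁ = rot-≈ {x₁} {y₁ ∷ x₂ ∷ y₂ ∷ x₃ ∷ y₃ ∷ []} e
      e₂ = rot-≈ {y₁} {x₂ ∷ y₂ ∷ x₃ ∷ y₃ ∷ x₁ ∷ []} e₁
      e₃ = rot-≈ {x₂} {y₂ ∷ x₃ ∷ y₃ ∷ x₁ ∷ y₁ ∷ []} e₂
      e₄ = rot-≈ {y₂} {x₃ ∷ y₃ ∷ x₁ ∷ y₁ ∷ x₂ ∷ []} e₃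
      e₅ = rot-≈ {x₃} {y₃ ∷ x₁ ∷ y₁ ∷ x₂ ∷ y₂ ∷ []} e₄

      t₁ : side v ≡ side y₁
      t₁ = ≢-≢⇒≡ (λ q → uv (≡-trans s₁ (≡-sym q))) (bip (cyc-edge c))
      s₂ : side u ≡ side x₂
      s₂ = ≢-≢⇒≡ (λ q → uv (≡-trans q (≡-sym t₁))) (bip (cyc-edge c₁))
      t₂ : side v ≡ side y₂
      t₂ = ≢-≢⇒≡ (λ q → uv (≡-trans s₂ (≡-sym q))) (bip (cyc-edge c₂))
      s₃ : side u ≡ side x₃
      s₃ = ≢-≢⇒≡ (λ q → uv (≡-trans q (≡-sym t₂))) (bip (cyc-edge c₃))
      t₃ : side v ≡ side y₃
      t₃ = ≢-≢⇒≡ (λ q → uv (≡-trans s₃ (≡-sym q))) (bip (cyc-edge c₄))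

      on-y on-x : V → B³
      on-y r = ⟨ adj r y₁ , adj r y₂ , adj r y₃ ⟩
      on-x r = ⟨ adj r x₁ , adj r x₂ , adj r x₃ ⟩

      count-y : ∀ {r} → side u ≡ side r → d r C ≡ count (on-y r)
      count-y {r} q rewrite ≡-sym (e (nb r))
        | nb-no {r} {x₁} (≡-trans (≡-sym q) s₁) | nb-no {r} {x₂} (≡-trans (≡-sym q) s₂) | nb-no {r} {x₃} (≡-trans (≡-sym q) s₃)
        = ar (nb r y₁) (nb r y₂) (nb r y₃)
        where
        ar : ∀ a b c → a + (b + (c + 0)) ≡ a + b + c
        ar = solve-∀

      count-x : ∀ {r} → side v ≡ side r → d r C ≡ count (on-x r)
      count-x {r} q rewrite ≡-sym (e (nb r))
        | nb-no {r} {y₁} (≡-trans (≡-sym q) t₁) | nb-no {r} {y₂} (≡-trans (≡-sym q) t₂) | nb-no {r} {y₃} (≡-trans (≡-sym q) t₃)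
        = ar (nb r x₁) (nb r x₂) (nb r x₃)
        where
        ar : ∀ a b c → a + (b + (c + 0)) ≡ a + b + c
        ar = solve-∀

      hexagon-bound : edges ≤ 12
      hexagon-bound = subst (_≤ 12)
        (≡-sym (cong₂ _+_ (cong₂ _+_ (cong₂ _+_ (cong₂ _+_ (cong₂ _+_ (count-y refl) (count-x refl)) (count-x vp)) (count-y uw)) (count-y ux)) (count-x vy)))
        (six (on-y u) (on-x v) (on-x p) (on-y w) (on-y x) (on-x y)
          (∨-false (one-x u-pv)) (∨-false (one-y v-wu)) (∨-false (one-x x-pv)) (∨-false (one-y y-wu))
          (∨-false (four-∧ (xpwv _ _ _ _ _ c₅ e₅) , four-∧ (xpwv _ _ _ _ _ c₁ e₁) , four-∧ (xpwv _ _ _ _ _ c₃ e₃)))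
          (∨-false (four-∧ (ywpu _ _ _ _ _ c e) , four-∧ (ywpu _ _ _ _ _ c₂ e₂) , four-∧ (ywpu _ _ _ _ _ c₄ e₄))))
        where
        ∨-false : ∀ {a b c} → a ≡ false × b ≡ false × c ≡ false → a ∨ b ∨ c ≡ false
        ∨-false (refl , refl , refl) = refl
        one-x : ∀ {r p v} → One C r p v → _
        one-x {r} {p} {v} o = four-∧ {adj r y₃} {adj r y₁} {adj p x₁} {adj v x₁} (o _ _ _ _ _ c₅ e₅) ,
                              four-∧ {adj r y₁} {adj r y₂} {adj p x₂} {adj v x₂} (o _ _ _ _ _ c₁ e₁) ,
                              four-∧ {adj r y₂} {adj r y₃} {adj p x₃} {adj v x₃} (o _ _ _ _ _ c₃ e₃)
        one-y : ∀ {r w u} → One C r w u → _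
        one-y {r} {w} {u} o = four-∧ {adj r x₁} {adj r x₂} {adj w y₁} {adj u y₁} (o _ _ _ _ _ c e) ,
                              four-∧ {adj r x₂} {adj r x₃} {adj w y₂} {adj u y₂} (o _ _ _ _ _ c₂ e₂) ,
                              four-∧ {adj r x₃} {adj r x₁} {adj w y₃} {adj u y₃} (o _ _ _ _ _ c₄ e₄)

    six-bound : ∀ {α} → Cyc C → length C ≡ 2 * suc α → 2 ≤ α → edges ≤ 6 * α
    six-bound {suc zero} c len (s≤s ())
    six-bound {suc (suc (suc α))} c len h = large-bound c len (s≤s (s≤s (s≤s z≤n)))
    six-bound {suc (suc zero)} c len h = small-case C c (λ f → refl) len
      where
      small-case : ∀ L → Cyc L → L ≈ C → length L ≡ 6 → edges ≤ 12
      small-case (z₁ ∷ z₂ ∷ z₃ ∷ z₄ ∷ z₅ ∷ z₆ ∷ []) c e refl with side-cases u z₁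
      ... | inj₁ s  = hexagon-bound c e s
      -- Reading the hexagon from its next vertex puts its first vertex on the side of `u`.
      ... | inj₂ ns = hexagon-bound (cyc-rot c)
                        (λ f → ≡-trans (S-∷ʳ f (z₂ ∷ z₃ ∷ z₄ ∷ z₅ ∷ z₆ ∷ []) z₁) (e f)) (≢-≢⇒≡ ns (bip (cyc-edge c)))

-- Sums over systems of cycles

module FamilySums {V : Set} where

  open ListSums {V}

  -- Cycles C, each with a number α standing for the requirement |C| ≥ 2 (α + 1).
  Fam : Set
  Fam = List (ℕ × List V)

  ΣF : (ℕ × List V → ℕ) → Fam → ℕ
  ΣF w []      = 0
  ΣF w (e ∷ F) = w e + ΣF w F

  SF : (V → ℕ) → Fam → ℕ
  SF f = ΣF (λ e → S f (proj₂ e))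

  ΣF-↭ : ∀ w {F F'} → F ↭ F' → ΣF w F ≡ ΣF w F'
  ΣF-↭ w refl         = refl
  ΣF-↭ w (prep x p)   = cong (w x +_) (ΣF-↭ w p)
  ΣF-↭ w (swap x y p) = ≡-trans (cong (λ t → w x + (w y + t)) (ΣF-↭ w p)) (+-left-comm (w x) (w y) _)
  ΣF-↭ w (trans p q)  = ≡-trans (ΣF-↭ w p) (ΣF-↭ w q)

  ΣF-+ : ∀ w w' F → ΣF (λ e → w e + w' e) F ≡ ΣF w F + ΣF w' F
  ΣF-+ w w' []      = refl
  ΣF-+ w w' (e ∷ F) = ≡-trans (cong (w e + w' e +_) (ΣF-+ w w' F)) (+-interchange (w e) (w' e) (ΣF w F) (ΣF w' F))

  ΣF-scale : ∀ k w F → ΣF (λ e → k * w e) F ≡ k * ΣF w F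
  ΣF-scale k w []      = ≡-sym (*-zeroʳ k)
  ΣF-scale k w (e ∷ F) = ≡-trans (cong (k * w e +_) (ΣF-scale k w F)) (≡-sym (*-distribˡ-+ k (w e) (ΣF w F)))

  -- The permutation records that `e` belongs to `F` and serves to bring it to the front, where
  -- cycles get modified.
  ΣF-mono : ∀ {w w'} F → (∀ e F' → F ↭ e ∷ F' → w e ≤ w' e) → ΣF w F ≤ ΣF w' F
  ΣF-mono []      k = z≤n
  ΣF-mono (e ∷ F) k =
    +-mono-≤ (k e F ↭-refl) (ΣF-mono F λ e' F' p → k e' (e ∷ F') (trans (prep e p) (swap e e' ↭-refl)))

  size : Fam → ℕ
  size = SF (λ _ → 1)

-- The search for the missing cycle

module Families {V : Set} (side : V → Bool) (adj : V → V → Bool)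
             (adj-sym : ∀ u v → adj u v ≡ adj v u)
             (bip : ∀ {u v} → adj u v ≡ true → side u ≢ side v) where

  open Paths side adj adj-sym bip public
  open SixVertices side adj adj-sym bip
  open FamilySums {V} public

  Good : ℕ × List V → Set
  Good (α , C) = Cyc C × 2 * suc α ≤ length C

  -- `tot` stands for the sum over all vertices, `reqs₀` for the requirements of the cycles at hand
  -- and `β` for that of the missing one. `success` refutes a complete system, so the statements
  -- inside can end in `⊥`.
  module Search (tot : (V → ℕ) → ℕ) (β : ℕ) (reqs₀ : List ℕ)
                (2≤β : 2 ≤ β) (2≤reqs : All (2 ≤_) reqs₀)
                (deg : ∀ u → sumᴸ reqs₀ + suc β ≤ tot (nb u))
                (balanced : ∀ u → tot (same u) ≡ tot (opp u))
                (success : ∀ F B R → map proj₁ F ↭ reqs₀ → All Good F → Cyc B → 2 * suc β ≤ length B →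
                           (∀ f → SF f F + (S f B + S f R) ≡ tot f) → ⊥) where

    -- Demanded for all weights at once, `cover` says that the cycles and `R` partition the vertex
    -- set.
    record Valid (F : Fam) (R : List V) : Set where
      constructor valid
      field
        reqs  : map proj₁ F ↭ reqs₀
        good  : All Good F
        cover : ∀ f → SF f F + S f R ≡ tot f
    open Valid public

    valid-↭ : ∀ {F F' R} → F ↭ F' → Valid F R → Valid F' R
    valid-↭ p (valid r g c) =
      valid (trans (map⁺ proj₁ (↭-sym p)) r) (All-resp-↭ p g) λ f → ≡-trans (cong (_+ _) (ΣF-↭ _ (↭-sym p))) (c f)

    valid-≈ : ∀ {F R R'} → R ≈ R' → Valid F R → Valid F R'
    valid-≈ e (valid r g c) = valid r g λ f → ≡-trans (cong (_ +_) (≡-sym (e f))) (c f)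

    valid-update : ∀ {α C F R C' R'} → Good (α , C') → C' ++ R' ≈ C ++ R →
                   Valid ((α , C) ∷ F) R → Valid ((α , C') ∷ F) R'
    valid-update {α} {C} {F} {R} {C'} {R'} g' e (valid r (_ ∷ g) c) = valid r (g' ∷ g) λ f →
      ≡-trans (≡-trans (mv (S f C') (SF f F) (S f R')) (≡-trans (cong (_+ SF f F) (eq f)) (≡-sym (mv (S f C) (SF f F) (S f R))))) (c f)
      where
      mv : ∀ a b c → a + b + c ≡ a + c + b
      mv = solve-∀
      eq : ∀ f → S f C' + S f R' ≡ S f C + S f R
      eq f = ≡-trans (≡-sym (S-++ f C' R')) (≡-trans (e f) (S-++ f C R))

    2≤α : ∀ {α C F R} → Valid ((α , C) ∷ F) R → 2 ≤ α
    2≤α v with All-resp-↭ (↭-sym (reqs v)) 2≤reqs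
    ... | h ∷ _ = h

    len4 : ∀ {α C F R} → Valid ((α , C) ∷ F) R → 4 ≤ length C
    len4 v with good v
    ... | (_ , h) ∷ _ = ≤-trans (≤-trans (s≤s (s≤s (s≤s (s≤s z≤n)))) (2 ⋆ s≤s (2≤α v))) h

    Σα : ∀ {F} → map proj₁ F ↭ reqs₀ → ΣF proj₁ F ≡ sumᴸ reqs₀
    Σα {F} p = ≡-trans (ΣF-sum F) (sum-↭ p)
      where
      ΣF-sum : ∀ F → ΣF proj₁ F ≡ sumᴸ (map proj₁ F)
      ΣF-sum []      = refl
      ΣF-sum (e ∷ F) = cong (proj₁ e +_) (ΣF-sum F)

    degree-sum : ∀ {F R} u → Valid F R → ΣF proj₁ F + suc β ≤ SF (nb u) F + d u R
    degree-sum {F} {R} u v = subst (λ t → t + suc β ≤ SF (nb u) F + d u R) (≡-sym (Σα (reqs v)))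
                       (≤-trans (deg u) (≤-reflexive (≡-sym (cover v (nb u)))))

    _∈ₘ_ : V → List V → Set
    r ∈ₘ R = ∃ λ R' → R ≈ r ∷ R'

    path-last : ∀ {a L b} → Path a L b → b ∈ₘ L
    path-last [ a ] = [] , λ f → refl
    path-last {b = b} (_∷_ {a} x P) with path-last P
    ... | M , e = a ∷ M , λ f → ≡-trans (cong (f a +_) (e f)) (+-left-comm (f a) (f b) (S f M))

    path-first : ∀ {a L b} → Path a L b → a ∈ₘ L
    path-first {a} [ a ]         = [] , λ f → refl
    path-first {a} (_∷_ {L = L} x P) = L , λ f → refl

    ∈ₘ-++ˡ : ∀ {r L} M → r ∈ₘ L → r ∈ₘ (L ++ M)
    ∈ₘ-++ˡ {r} {L} M (L' , e) = L' ++ M , λ f →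
      ≡-trans (S-++ f L M) (≡-trans (cong (_+ S f M) (e f)) (≡-trans (+-assoc (f r) _ _) (cong (f r +_) (≡-sym (S-++ f L' M)))))

    -- The part of `P` from `u` to its last neighbour closes to a cycle with at least twice as many
    -- vertices as `u` has neighbours on `P`. With β + 1 neighbours this would be the missing cycle.
    end-close : ∀ {F R P K u v} → Valid F R → R ≈ P ++ K → Path u P v → d u P ≤ β
    end-close {F} {R} {P} {K} {u} {v} V e Pa with d u P ≤? β
    ... | yes h = h
    ... | no  h with last-nbr u Pa (≤-trans (s≤s z≤n) (≰⇒> h))
    ...   | A , B , z , refl , PA , uz , zB = ⊥-elim (success F A (B ++ K) (reqs V) (good V)
              (u , z , PA , ~-sym uz)
              (≤-trans (2 ⋆ ≤-trans (≰⇒> h) (≤-reflexive dA)) (count-path′ u PA refl))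
              λ f → ≡-trans (cong (SF f F +_) (≡-sym (≡-trans (e f) (eq f)))) (cover V f))
      where
      dA : d u (A ++ B) ≡ d u A
      dA = ≡-trans (S-++ (nb u) A B) (≡-trans (cong (d u A +_) zB) (+-identityʳ _))
      eq : ∀ f → S f ((A ++ B) ++ K) ≡ S f A + S f (B ++ K)
      eq f = ≡-trans (cong (S f) (++-assoc A B K)) (S-++ f A (B ++ K))

    module _ {α C F R} (v : Valid ((α , C) ∷ F) R) where

      good₁ : Good (α , C)
      good₁ with good v
      ... | g ∷ _ = g

      goods : All Good F
      goods with good v
      ... | _ ∷ g = g

    -- Trading `u` for `z₂` keeps the length of `C`, and `z₂` closes the rest of the path to the
    -- missing cycle.
    state-one : ∀ {α C F K u p v P} → Valid ((α , C) ∷ F) ((u ∷ P) ++ K) → Path p P v →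
                2 * suc β ≤ suc (length P) → One C u p v
    state-one {α} {C} {F} {K} {u} {p} {v} {P} V Pp big z₁ z₂ z₃ z₄ L cl@(_ , b , _ ∷ (_ ∷ P₃) , bz) e uz₁ uz₃ pz₂ vz₂ =
      success ((α , u ∷ L₀) ∷ F) (z₂ ∷ P) K (reqs V)
        (((u , z₁ , uz₃ ∷ path-∷ʳ (path-start P₃) bz , ~-sym uz₁) , ≤-trans (proj₂ (good₁ V)) (≤-reflexive len)) ∷ goods V)
        (z₂ , v , ~-sym pz₂ ∷ Pp , vz₂) big
        λ f → ≡-trans (ar (f u) (f z₁) (f z₂) (S f (z₃ ∷ z₄ ∷ L)) (S f P) (S f K) (SF f F) (S-∷ʳ f (z₃ ∷ z₄ ∷ L) z₁) (e f) (S-++ f P K)) (cover V f)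
      where
      L₀ = (z₃ ∷ z₄ ∷ L) ++ z₁ ∷ []
      len : length C ≡ length (u ∷ L₀)
      len = ≡-trans (≡-sym (≈-length {z₁ ∷ z₂ ∷ z₃ ∷ z₄ ∷ L} {C} e))
                    (cong suc (≡-trans (+-comm 1 (length (z₃ ∷ z₄ ∷ L))) (≡-sym (length-++ (z₃ ∷ z₄ ∷ L) {z₁ ∷ []}))))
      ar : ∀ u z₁ z₂ l p k F {c l₀ q} → l₀ ≡ z₁ + l → z₁ + (z₂ + l) ≡ c → q ≡ p + k →
           u + l₀ + F + (z₂ + p + k) ≡ c + F + (u + q)
      ar u z₁ z₂ l p k F refl refl refl = ar′ u z₁ z₂ l p k F
        where
        ar′ : ∀ u z₁ z₂ l p k F → u + (z₁ + l) + F + (z₂ + p + k) ≡ z₁ + (z₂ + l) + F + (u + (p + k))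
        ar′ = solve-∀

    state-two : ∀ {α C F K a b c e P} → Valid ((α , C) ∷ F) ((a ∷ e ∷ P) ++ K) → a ~ e → Path c P b →
                2 * suc β ≤ suc (suc (length P)) → Two C a b c e
    state-two {α} {C} {F} {K} {a} {b} {c} {e} {P} V ae Pc big z₁ z₂ z₃ z₄ L cl@(_ , l , _ ∷ (_ ∷ (_ ∷ P₄)) , lz) eq az₁ bz₂ cz₃ ez₄ =
      success ((α , a ∷ e ∷ L₀) ∷ F) (z₂ ∷ z₃ ∷ P) K (reqs V)
        (((a , z₁ , ae ∷ (ez₄ ∷ path-∷ʳ (path-start P₄) lz) , ~-sym az₁) , ≤-trans (proj₂ (good₁ V)) (≤-reflexive len)) ∷ goods V)
        (z₂ , b , cyc-edge₂ cl ∷ (~-sym cz₃ ∷ Pc) , bz₂) big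
        λ f → ≡-trans (ar (f a) (f e) (f z₁) (f z₂) (f z₃) (S f (z₄ ∷ L)) (S f P) (S f K) (SF f F) (S-∷ʳ f (z₄ ∷ L) z₁) (eq f) (S-++ f P K)) (cover V f)
      where
      L₀ = (z₄ ∷ L) ++ z₁ ∷ []
      len : length C ≡ length (a ∷ e ∷ L₀)
      len = ≡-trans (≡-sym (≈-length {z₁ ∷ z₂ ∷ z₃ ∷ z₄ ∷ L} {C} eq))
                    (cong (λ t → suc (suc t)) (≡-trans (+-comm 1 (length (z₄ ∷ L))) (≡-sym (length-++ (z₄ ∷ L) {z₁ ∷ []}))))
      ar : ∀ a e z₁ z₂ z₃ l p k F {c l₀ q} → l₀ ≡ z₁ + l → z₁ + (z₂ + (z₃ + l)) ≡ c → q ≡ p + k →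
           a + (e + l₀) + F + (z₂ + (z₃ + p) + k) ≡ c + F + (a + (e + q))
      ar a e z₁ z₂ z₃ l p k F refl refl refl = ar′ a e z₁ z₂ z₃ l p k F
        where
        ar′ : ∀ a e z₁ z₂ z₃ l p k F → a + (e + (z₁ + l)) + F + (z₂ + (z₃ + p) + k) ≡ z₁ + (z₂ + (z₃ + l)) + F + (a + (e + (p + k)))
        ar′ = solve-∀

    total : ℕ
    total = tot (λ _ → 1)

    -- Systems of cycles with as few vertices as possible

    module Level (s : ℕ) (room : s + 2 * suc β ≤ total)
                 (noSmaller : ∀ F R → Valid F R → size F < s → ⊥) where

      record State (F : Fam) (R : List V) : Set where
        constructor state
        field
          valid′ : Valid F R
          size≡  : size F ≡ s
      open State public

      state-↭ : ∀ {F F' R} → F ↭ F' → State F R → State F' R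
      state-↭ p (state v e) = state (valid-↭ p v) (≡-trans (ΣF-↭ _ (↭-sym p)) e)

      state-≈ : ∀ {F R R'} → R ≈ R' → State F R → State F R'
      state-≈ e (state v q) = state (valid-≈ e v) q

      state-update : ∀ {α C F R C' R'} → Good (α , C') → length C' ≡ length C → C' ++ R' ≈ C ++ R →
                     State ((α , C) ∷ F) R → State ((α , C') ∷ F) R'
      state-update {C = C} {F} {C' = C'} g l e (state v q) =
        state (valid-update g e v) (≡-trans (cong (_+ size F) (≡-trans (S-1 C') (≡-trans l (≡-sym (S-1 C))))) q)

      -- With α + 1 neighbours on a cycle longer than 2 (α + 1), `shorten` would give a smaller
      -- system, the vertices cut off going to `R`. On a cycle of exactly that length, half of the
      -- vertices are on the side opposite to `r`.
      small : ∀ {α C F R r} → State ((α , C) ∷ F) R → r ∈ₘ R →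
              d r C ≤ α ⊎ (d r C ≤ suc α × length C ≡ 2 * suc α)
      small {α} {C} {F} {R} {r} St@(state v q) (R' , e) with good v | length C ≟ 2 * suc α
      ... | (cyc , le) ∷ _ | yes eq =
            inj₂ (*-cancelˡ-≤ 2 (≤-trans (d≤half r cyc (len4 v)) (≤-reflexive eq)) , eq)
      ... | (cyc , le) ∷ _ | no ne with d r C ≤? α
      ...   | yes h = inj₁ h
      ...   | no  h = ⊥-elim (shorten r cyc (s≤s z≤n) (len4 v) (≰⇒> h) (≤∧≢⇒< le (ne ∘ ≡-sym))
                λ M D cM eq l₁ l₂ → noSmaller _ _ (valid-update (cM , l₁) (mv M D eq) v)
                  (subst (size ((α , r ∷ M) ∷ F) <_) q
                    (+-monoˡ-< (size F) (subst (_< S (λ _ → 1) C) (≡-sym (S-1 (r ∷ M))) (subst (length (r ∷ M) <_) (≡-sym (S-1 C)) l₂)))))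
        where
        ar : ∀ a b c e → a + (b + (c + e)) ≡ c + b + (a + e)
        ar = solve-∀
        mv : ∀ M D → D ++ M ≈ C → (r ∷ M) ++ (D ++ R') ≈ C ++ R
        mv M D eq f = ≡-trans (cong (f r +_) (≡-trans (S-++ f M (D ++ R')) (cong (S f M +_) (S-++ f D R'))))
          (≡-trans (ar (f r) (S f M) (S f D) (S f R'))
          (≡-trans (cong₂ _+_ (≡-trans (≡-sym (S-++ f D M)) (eq f)) (≡-sym (e f))) (≡-sym (S-++ f C R))))

      small≤ : ∀ {α C F R r} → State ((α , C) ∷ F) R → r ∈ₘ R → d r C ≤ suc α
      small≤ St r∈ with small St r∈
      ... | inj₁ h       = m≤n⇒m≤1+n h
      ... | inj₂ (h , _) = h

      -- One of the two vertices has more than α neighbours on `C`, which `small` admits only when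
      -- `C` is as short as allowed.
      exact : ∀ {α C F R r F₁ R₁ t} → State ((α , C) ∷ F) R → r ∈ₘ R → State ((α , C) ∷ F₁) R₁ → t ∈ₘ R₁ →
              suc (2 * α) ≤ d r C + d t C → length C ≡ 2 * suc α
      exact {α} {C} {r = r} {t = t} St r∈ St₁ t∈ h with small St r∈ | small St₁ t∈
      ... | inj₂ (_ , e) | _            = e
      ... | inj₁ _       | inj₂ (_ , e) = e
      ... | inj₁ h₁      | inj₁ h₂      = ⊥-elim (<-irrefl refl (exact-arith (d r C) (d t C) α h h₁ h₂))

      swap-in : ∀ {α C F R r R' z L a b} → State ((α , C) ∷ F) R → R ≈ r ∷ R' →
                C ≈ z ∷ L → Path a L b → r ~ a → b ~ r → State ((α , r ∷ L) ∷ F) (z ∷ R')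
      swap-in {α} {C} {F} {R} {r} {R'} {z} {L} St e eC P ra br with good (valid′ St)
      ... | (_ , le) ∷ _ = state-update ((r , _ , ra ∷ P , br) , ≤-trans le (≤-reflexive len)) (≡-sym len) eq St
        where
        len : length C ≡ suc (length L)
        len = ≈-length {C} {z ∷ L} eC
        ar : ∀ a b c e → a + (b + (c + e)) ≡ c + b + (a + e)
        ar = solve-∀
        eq : (r ∷ L) ++ z ∷ R' ≈ C ++ R
        eq f = ≡-trans (cong (f r +_) (S-++ f L (z ∷ R'))) (≡-trans (ar (f r) (S f L) (f z) (S f R'))
               (≡-trans (cong₂ _+_ (≡-sym (eC f)) (≡-sym (e f))) (≡-sym (S-++ f C R))))

      -- Pigeonhole: if the two vertices had at most 2 α neighbours on every cycle, they would have
      -- at most 2 Σ α in all.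
      heavy : ∀ {F R} → Valid F R → ∀ r t → suc (2 * sumᴸ reqs₀) ≤ SF (nb r) F + SF (nb t) F →
              (∀ α C F' → F ↭ (α , C) ∷ F' → suc (2 * α) ≤ d r C + d t C → ⊥) → ⊥
      heavy {F} v r t h k = <-irrefl refl (begin-strict
        SF (nb r) F + SF (nb t) F            ≡⟨ ≡-sym (ΣF-+ _ _ F) ⟩
        ΣF (λ e → d r (proj₂ e) + d t (proj₂ e)) F
          ≤⟨ ΣF-mono F (λ e F' p → ≮⇒≥ (λ q → k (proj₁ e) (proj₂ e) F' p q)) ⟩
        ΣF (λ e → 2 * proj₁ e) F             ≡⟨ ΣF-scale 2 proj₁ F ⟩
        2 * ΣF proj₁ F                       ≡⟨ cong (2 *_) (Σα (reqs v)) ⟩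
        2 * sumᴸ reqs₀                        <⟨ h ⟩
        SF (nb r) F + SF (nb t) F            ∎)
        where open ≤-Reasoning

      -- With so few neighbours in `R`, the two vertices have at least 2 Σ α + 1 on the cycles,
      -- hence at least 2 α + 1 on one of them. There `r` replaces a neighbour `z` of `t`, and `z`
      -- joins the rest; the size does not change.
      exchange : ∀ {F R r R' t} → State F R → R ≈ r ∷ R' → t ∈ₘ R → side r ≢ side t →
                 d r R + d t R ≤ suc (2 * β) →
                 (∀ F' z → t ~ z → State F' (z ∷ R') → ⊥) → ⊥
      exchange {F} {R} {r} {R'} {t} St e t∈ ne low k =
        heavy (valid′ St) r t
          (heavy-arith β (sumᴸ reqs₀) (SF (nb r) F) (SF (nb t) F) (d r R) (d t R)
            (subst (λ q → q + suc β ≤ _) (Σα (reqs (valid′ St))) (degree-sum r (valid′ St)))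
            (subst (λ q → q + suc β ≤ _) (Σα (reqs (valid′ St))) (degree-sum t (valid′ St))) low)
          λ α C F' p h →
            let St' = state-↭ p St
                len = exact St' (R' , e) St' t∈ h
            in find-swap r t ne (cyc St') len (2≤α (valid′ St')) (small≤ St' (R' , e)) (small≤ St' t∈) h
                 λ z L a b eC P ra br tz → k _ z tz (swap-in St' e eC P ra br)
        where
        cyc : ∀ {α C F R} → State ((α , C) ∷ F) R → Cyc C
        cyc St with good (valid′ St)
        ... | (c , _) ∷ _ = c

      rest-length : ∀ {F R} → State F R → length R ≤ total
      rest-length {F} {R} St = ≤-trans (≤-reflexive (≡-sym (S-1 R)))
        (≤-trans (m≤n+m (S (λ _ → 1) R) (size F)) (≤-reflexive (cover (valid′ St) (λ _ → 1))))

      rest-long : ∀ {F R} → State F R → 2 * suc β ≤ length R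
      rest-long {F} {R} St = +-cancelˡ-≤ s _ _ (≤-trans room (≤-reflexive
        (≡-trans (≡-sym (cover (valid′ St) (λ _ → 1))) (cong₂ _+_ (size≡ St) (S-1 R)))))

      -- Longest paths outside the cycles whose leftover is perfectly matched

      module Longest (ℓ : ℕ)
        (noLonger : ∀ F P K u v → State F (P ++ K) → Path u P v → side u ≢ side v → Matched K → ℓ < length P → ⊥) where

        ++-congˡ : ∀ {P P'} K → P ≈ P' → P ++ K ≈ P' ++ K
        ++-congˡ {P} {P'} K e f = ≡-trans (S-++ f P K) (≡-trans (cong (_+ S f K) (e f)) (≡-sym (S-++ f P' K)))

        reverse-≈ : ∀ L → L ≈ reverse L
        reverse-≈ L f = ≡-sym (S-reverse f L)

        d-++ : ∀ u L M → d u (L ++ M) ≡ d u L + d u M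
        d-++ u = S-++ (nb u)

        -- A neighbour `z` in `K` and its partner `z'` would both prolong the path at `u`.
        end-no-nbr : ∀ {F P K u v} → State F (P ++ K) → Path u P v → side u ≢ side v → Matched K → length P ≡ ℓ → d u K ≡ 0
        end-no-nbr {F} {P} {K} {u} {v} St Pa ne mK len with d u K in eq
        ... | zero  = refl
        ... | suc _ with matched-nbr u mK (subst (1 ≤_) (≡-sym eq) (s≤s z≤n))
        ...   | z , z' , M , uz , zz' , mM , e =
          ⊥-elim (noLonger F (z' ∷ z ∷ P) M z' v (state-≈ mv St) (~-sym zz' ∷ (~-sym uz ∷ Pa))
            (λ q → ne (≡-trans (≢-≢⇒≡ (bip uz) (bip zz')) q)) mM (subst (λ t → t < suc (suc (length P))) len (s≤s (n≤1+n _))))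
          where
          ar : ∀ a b c e → a + (b + (c + e)) ≡ c + (b + (a + e))
          ar = solve-∀
          mv : P ++ K ≈ (z' ∷ z ∷ P) ++ M
          mv f = ≡-trans (≡-trans (S-++ f P K) (cong (S f P +_) (e f)))
                 (≡-trans (ar (S f P) (f z) (f z') (S f M)) (cong (λ t → f z' + (f z + t)) (≡-sym (S-++ f P M))))

        NoLongerSecond : Fam → List V → ℕ → Set
        NoLongerSecond F P m = ∀ Q K h g → State F (P ++ (Q ++ K)) → Path h Q g → side h ≢ side g → Matched K → m < length Q → ⊥

        low-first : ∀ {F P Q K u v h g} → ℓ < 2 * suc β → State F (P ++ (Q ++ K)) → length P ≡ ℓ → Path u P v → side u ≢ side v →
                    Path h Q g → side h ≢ side g → Matched K → d u (P ++ (Q ++ K)) ≤ β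
        low-first {F} {P} {Q} {K} {u} lt St len Pu uv Ph hg mK = half-< (d u (P ++ (Q ++ K))) ℓ β
          (subst₂ (λ s t → 2 * s ≤ t)
            (≡-sym (≡-trans (d-++ u P (Q ++ K)) (≡-trans (cong (d u P +_) (end-no-nbr St Pu uv (matched-++ (path-matched Ph hg) mK) len)) (+-identityʳ _))))
            len (count-path′ u Pu refl)) lt

        -- If `h` has a neighbour on `P`, let `e` be the first one. Then `Q` reversed and continued
        -- along `P` from `e` is a path whose leftovers are matched, so it has at most ℓ vertices,
        -- and at most half of them are neighbours of `h`. Otherwise all neighbours of `h` are on
        -- `Q`, which itself has at most ℓ vertices.
        low-second : ∀ {F P Q K u v h g} → ℓ < 2 * suc β → State F (P ++ (Q ++ K)) → length P ≡ ℓ → Path u P v → side u ≢ side v →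
                     Path h Q g → side h ≢ side g → side h ≢ side u → Matched K → NoLongerSecond F P (length Q) →
                     d h (P ++ (Q ++ K)) ≤ β
        low-second {F} {P} {Q} {K} {u} {v} {h} {g} lt St len Pu uv Ph hg hu mK noQ =
          half-< (d h (P ++ (Q ++ K))) ℓ β (subst (λ s → 2 * s ≤ ℓ) (≡-sym d-total) (bound (d h P) refl)) lt
          where
          ar : ∀ a b c e f → a + (b + (c + (e + f))) ≡ a + (e + (c + (b + f)))
          ar = solve-∀
          dK : d h K ≡ 0
          dK with d h K in eq
          ... | zero  = refl
          ... | suc _ with matched-nbr h mK (subst (1 ≤_) (≡-sym eq) (s≤s z≤n))
          ...   | z , z' , M , hz , zz' , mM , e = ⊥-elim (noQ (z' ∷ z ∷ Q) M z' g (state-≈ mv St) (~-sym zz' ∷ (~-sym hz ∷ Ph))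
                    (λ q → hg (≡-trans (≢-≢⇒≡ (bip hz) (bip zz')) q)) mM (s≤s (n≤1+n _)))
            where
            mv : P ++ (Q ++ K) ≈ P ++ ((z' ∷ z ∷ Q) ++ M)
            mv f = ≡-trans (S-++ f P (Q ++ K)) (≡-trans (cong (S f P +_) (≡-trans (S-++ f Q K) (cong (S f Q +_) (e f))))
                   (≡-trans (ar₂ (S f P) (S f Q) (f z) (f z') (S f M))
                   (≡-trans (cong (λ t → S f P + (f z' + (f z + t))) (≡-sym (S-++ f Q M))) (≡-sym (S-++ f P _)))))
              where
              ar₂ : ∀ a b c e f → a + (b + (c + (e + f))) ≡ a + (e + (c + (b + f)))
              ar₂ = solve-∀
          d-total : d h (P ++ (Q ++ K)) ≡ d h P + d h Q
          d-total = ≡-trans (d-++ h P (Q ++ K)) (cong (d h P +_) (≡-trans (d-++ h Q K) (≡-trans (cong (d h Q +_) dK) (+-identityʳ _))))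
          Q≤ : length Q ≤ ℓ
          Q≤ = ≮⇒≥ (noLonger F Q (P ++ K) h g (state-≈ mv St) Ph hg (matched-++ (path-matched Pu uv) mK))
            where
            mv : P ++ (Q ++ K) ≈ Q ++ (P ++ K)
            mv f = ≡-trans (≡-trans (S-++ f P (Q ++ K)) (cong (S f P +_) (S-++ f Q K)))
                   (≡-trans (+-left-comm (S f P) (S f Q) (S f K)) (≡-sym (≡-trans (S-++ f Q (P ++ K)) (cong (S f Q +_) (S-++ f P K)))))
          bound : ∀ n → d h P ≡ n → 2 * (d h P + d h Q) ≤ ℓ
          bound zero    eq = subst (λ t → 2 * (t + d h Q) ≤ ℓ) (≡-sym eq) (≤-trans (count-path′ h Ph refl) Q≤)
          bound (suc n) eq with first-nbr h Pu (subst (1 ≤_) (≡-sym eq) (s≤s z≤n))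
          ... | A , B , e , refl , PB , he , zA , fr = second-arith (d h (A ++ B)) (d h B) (d h Q) (length B) (length Q) ℓ
                (≡-trans (d-++ h A B) (cong (_+ d h B) zA))
                (subst₂ (λ s t → 2 * s ≤ t) (S-reverse (nb h) B) (length-reverse B) (count-path′ h (path-reverse PB) hv))
                (count-path′ h Ph refl)
                (subst (_≤ ℓ) (≡-trans (length-++ (reverse Q)) (cong (_+ length B) (length-reverse Q)))
                  (≮⇒≥ (noLonger F (reverse Q ++ B) (A ++ K) g v (state-≈ mv St) (path-++ (path-reverse Ph) he PB)
                    (λ q → hg (≡-trans hv (≡-sym q))) (matched-++ (front-matched fr (≢-≢⇒≡ (hu ∘ ≡-sym) (bip he))) mK))))
            where
            hv : side h ≡ side v
            hv = ≢-≢⇒≡ hu uv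
            ar₄ : ∀ a b c e → a + b + (c + e) ≡ c + b + (a + e)
            ar₄ = solve-∀
            mv : (A ++ B) ++ (Q ++ K) ≈ (reverse Q ++ B) ++ (A ++ K)
            mv f = ≡-trans (≡-trans (S-++ f (A ++ B) (Q ++ K)) (cong₂ _+_ (S-++ f A B) (S-++ f Q K)))
                   (≡-trans (ar₄ (S f A) (S f B) (S f Q) (S f K))
                   (≡-sym (≡-trans (S-++ f (reverse Q ++ B) (A ++ K))
                     (cong₂ _+_ (≡-trans (S-++ f (reverse Q) B) (cong (_+ S f B) (S-reverse f Q))) (S-++ f A K)))))

        -- The ends `h` and `g` of the second path are exchanged for a neighbour `z` of `u` and a
        -- neighbour `x` of `v`. Then `P` grows at both ends, and the second path without its ends
        -- is still matched.
        double-exchange : ∀ {F P Q₁ K u v h h₁ g} → ℓ < 2 * suc β → State F (P ++ ((h ∷ Q₁) ++ K)) → length P ≡ ℓ →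
                          Path u P v → side u ≢ side v → h ~ h₁ → Path h₁ Q₁ g → side h ≢ side g → side h ≢ side u →
                          Matched K → NoLongerSecond F P (length (h ∷ Q₁)) → ⊥
        double-exchange {F} {P} {Q₁} {K} {u} {v} {h} {h₁} {g} lt St len Pu uv e₁ Ph hg hu mK noQ with path-unsnoc Ph
        ... | Q₂ , refl , fr =
          exchange {R' = R₁} St out-h (∈ₘ-++ˡ {u} {P} (Q ++ K) (path-first Pu)) hu
            (≤-trans (+-mono-≤ low-h low-u) (≤-trans (≤-reflexive (cong (β +_) (≡-sym (+-identityʳ β)))) (n≤1+n _)))
            -- The vertex `z` has joined the rest. It may raise the degree of `g` by 1, but not that
            -- of `v`, whose side it shares; hence the bound 2 β + 1 in `exchange`.
            λ F' z uz St' → exchange {R' = z ∷ (P ++ (Q₂ ++ K))} St' (out-g z) (v∈ z) gv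
              (rest-arith β (nb g z) (d g R₁) (nb v z) (d v R₁) (nb g h) (nb v h) (nb≤1 g z)
                (nb-no {v} {z} (≢-≢⇒≡ (uv ∘ ≡-sym) (bip uz)))
                (subst (_≤ β) (out-h (nb g)) low-g) (subst (_≤ β) (out-h (nb v)) low-v))
              λ F'' x vx St'' → noLonger F'' (z ∷ (P ++ x ∷ [])) (Q₂ ++ K) z x (state-≈ (join z x) St'')
                (~-sym uz ∷ path-∷ʳ Pu vx)
                (λ q → bip vx (≡-trans (≢-≢⇒≡ (uv ∘ ≡-sym) (bip uz)) q))
                (matched-++ (front-matched fr (≢-≢⇒≡ (bip (~-sym e₁)) hg)) mK)
                (subst (_< suc (length (P ++ x ∷ []))) len
                  (s≤s (subst (length P ≤_) (≡-sym (length-++ P)) (m≤m+n (length P) 1))))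
          where
          Q = h ∷ Q₁
          R = P ++ (Q ++ K)
          R₁ = P ++ (Q₁ ++ K)
          hv : side h ≡ side v
          hv = ≢-≢⇒≡ hu uv
          gv : side g ≢ side v
          gv q = hg (≡-trans hv (≡-sym q))
          out-h : R ≈ h ∷ R₁
          out-h f = ≡-trans (S-++ f P (Q ++ K)) (≡-trans (+-left-comm (S f P) (f h) (S f (Q₁ ++ K))) (cong (f h +_) (≡-sym (S-++ f P (Q₁ ++ K)))))
          expand : ∀ f → S f R₁ ≡ S f P + ((f g + S f Q₂) + S f K)
          expand f = ≡-trans (S-++ f P (Q₁ ++ K)) (cong (S f P +_) (≡-trans (S-++ f Q₁ K) (cong (_+ S f K) (S-∷ʳ f Q₂ g))))
          out-g : ∀ z → z ∷ R₁ ≈ g ∷ (z ∷ (P ++ (Q₂ ++ K)))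
          out-g z f = ≡-trans (cong (f z +_) (expand f)) (≡-trans (ar (f z) (S f P) (f g) (S f Q₂) (S f K))
            (cong (λ t → f g + (f z + t)) (≡-sym (≡-trans (S-++ f P (Q₂ ++ K)) (cong (S f P +_) (S-++ f Q₂ K))))))
            where
            ar : ∀ a b c e k → a + (b + ((c + e) + k)) ≡ c + (a + (b + (e + k)))
            ar = solve-∀
          v∈ : ∀ z → v ∈ₘ (z ∷ R₁)
          v∈ z with ∈ₘ-++ˡ {v} {P} (Q₁ ++ K) (path-last Pu)
          ... | M , e = z ∷ M , λ f → ≡-trans (cong (f z +_) (e f)) (+-left-comm (f z) (f v) (S f M))
          join : ∀ z x → x ∷ (z ∷ (P ++ (Q₂ ++ K))) ≈ (z ∷ (P ++ x ∷ [])) ++ (Q₂ ++ K)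
          join z x f = ≡-trans (cong (λ t → f x + (f z + t)) (S-++ f P (Q₂ ++ K)))
            (≡-trans (ar (f x) (f z) (S f P) (S f (Q₂ ++ K)))
            (cong (f z +_) (≡-sym (≡-trans (S-++ f (P ++ x ∷ []) (Q₂ ++ K)) (cong (_+ S f (Q₂ ++ K)) (S-∷ʳ f P x))))))
            where
            ar : ∀ a b c e → a + (b + (c + e)) ≡ b + ((a + c) + e)
            ar = solve-∀
          low-u : d u R ≤ β
          low-u = low-first lt St len Pu uv (e₁ ∷ Ph) hg mK
          low-h : d h R ≤ β
          low-h = low-second lt St len Pu uv (e₁ ∷ Ph) hg hu mK noQ
          revP≈ : ∀ M → P ++ M ≈ reverse P ++ M
          revP≈ M = ++-congˡ {P} {reverse P} M (reverse-≈ P)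
          rev≈ : R ≈ reverse P ++ (reverse Q ++ K)
          rev≈ f = ≡-trans (S-++ f P (Q ++ K)) (≡-trans (cong₂ _+_ (reverse-≈ P f) (++-congˡ {Q} {reverse Q} K (reverse-≈ Q) f))
                   (≡-sym (S-++ f (reverse P) (reverse Q ++ K))))
          St-rev : State F (reverse P ++ (reverse Q ++ K))
          St-rev = state-≈ rev≈ St
          len-rev : length (reverse P) ≡ ℓ
          len-rev = ≡-trans (length-reverse P) len
          noQ-rev : NoLongerSecond F (reverse P) (length (reverse Q))
          noQ-rev Q' K' h' g' St' Ph' ne' mK' l = noQ Q' K' h' g' (state-≈ (λ f → ≡-sym (revP≈ (Q' ++ K') f)) St') Ph' ne' mK'
            (subst (_< length Q') (length-reverse Q) l)
          low-v : d v R ≤ β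
          low-v = subst (_≤ β) (≡-sym (rev≈ (nb v)))
            (low-first lt St-rev len-rev (path-reverse Pu) (uv ∘ ≡-sym) (path-reverse (e₁ ∷ Ph)) (hg ∘ ≡-sym) mK)
          low-g : d g R ≤ β
          low-g = subst (_≤ β) (≡-sym (rev≈ (nb g)))
            (low-second lt St-rev len-rev (path-reverse Pu) (uv ∘ ≡-sym) (path-reverse (e₁ ∷ Ph)) (hg ∘ ≡-sym) gv mK noQ-rev)

        second-length : ∀ {F} P Q {K} → State F (P ++ (Q ++ K)) → length Q ≤ total
        second-length P Q {K} St = ≤-trans (≤-trans (m≤m+n (length Q) (length K)) (≤-reflexive (≡-sym (length-++ Q))))
          (≤-trans (m≤n+m (length (Q ++ K)) (length P)) (≤-trans (≤-reflexive (≡-sym (length-++ P))) (rest-length St)))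

        longest-second : ∀ {F P Q K u v h g} → ℓ < 2 * suc β → State F (P ++ (Q ++ K)) → length P ≡ ℓ →
                         Path u P v → side u ≢ side v → Path h Q g → side h ≢ side g → Matched K →
                         NoLongerSecond F P (length Q) → ⊥
        longest-second {F} {P} {Q} {K} {u} {v} {h} {g} lt St len Pu uv Ph hg mK noQ = orient (side-cases h u)
          where
          start : ∀ {h g Q} → Path h Q g → side h ≢ side g → side h ≢ side u → State F (P ++ (Q ++ K)) →
                  NoLongerSecond F P (length Q) → ⊥
          start [ _ ]     ne hu St nq = ne refl
          start (e₁ ∷ Ph) ne hu St nq = double-exchange lt St len Pu uv e₁ Ph ne hu mK nq
          orient : side h ≡ side u ⊎ side h ≢ side u → ⊥
          orient (inj₂ hu) = start Ph hg hu St noQ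
          orient (inj₁ hu) = start (path-reverse Ph) (hg ∘ ≡-sym) (λ q → hg (≡-trans hu (≡-sym q)))
                (state-≈ (λ f → ≡-trans (S-++ f P (Q ++ K)) (≡-trans (cong (S f P +_) (++-congˡ {Q} {reverse Q} K (reverse-≈ Q) f))
                                (≡-sym (S-++ f P (reverse Q ++ K))))) St)
                (λ Q' K' h' g' St' Ph' ne' mK' l → noQ Q' K' h' g' St' Ph' ne' mK' (subst (_< length Q') (length-reverse Q) l))

        -- Induction on the possible growth of `Q`, bounded by `total`, takes the place of choosing
        -- `Q` longest.
        no-second : ∀ n {F P Q K u v h g} → ℓ < 2 * suc β → State F (P ++ (Q ++ K)) → length P ≡ ℓ →
                    Path u P v → side u ≢ side v → Path h Q g → side h ≢ side g → Matched K → total ≤ n + length Q → ⊥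
        no-second zero {P = P} lt St len Pu uv Ph hg mK fuel = longest-second lt St len Pu uv Ph hg mK
          λ Q' K' h' g' St' Ph' ne' mK' l → <-irrefl refl (≤-trans l (≤-trans (second-length P Q' St') fuel))
        no-second (suc n) {Q = Q} lt St len Pu uv Ph hg mK fuel = longest-second lt St len Pu uv Ph hg mK
          λ Q' K' h' g' St' Ph' ne' mK' l → no-second n lt St' len Pu uv Ph' ne' mK'
            (≤-trans fuel (≤-trans (≤-reflexive (≡-sym (+-suc n (length Q)))) (+-monoʳ-≤ n l)))

        -- Otherwise K is nonempty, and the ends of a longest path covering pairs of K can be
        -- exchanged for vertices that prolong P at both ends.
        long : ∀ {F P K u v} → State F (P ++ K) → length P ≡ ℓ → Path u P v → side u ≢ side v → Matched K →
               2 * suc β ≤ length (P ++ K) → 2 * suc β ≤ ℓ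
        long {P = P} {K} St len Pu uv mK big with 2 * suc β ≤? ℓ
        ... | yes h = h
        ... | no  h = ⊥-elim (go St mK big)
          where
          go : ∀ {K} → State _ (P ++ K) → Matched K → 2 * suc β ≤ length (P ++ K) → ⊥
          go St []         big = h (≤-trans big (≤-reflexive (≡-trans (cong length (++-identityʳ P)) len)))
          go St (pair {x} {y} e m) big = no-second total (≰⇒> h) St len Pu uv (e ∷ [ y ]) (bip e) m (m≤m+n total 2)

        -- By maximality `u` has no neighbour in `K`, and by `end-close` at most β on `P`; all its
        -- other neighbours are on the cycles.
        end-degree : ∀ {F P K u v} → State F (P ++ K) → Path u P v → side u ≢ side v → Matched K → length P ≡ ℓ →
                     suc (sumᴸ reqs₀) ≤ SF (nb u) F
        end-degree {F} {P} {K} {u} St Pu uv mK len =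
          end-arith β (sumᴸ reqs₀) (SF (nb u) F) (d u P) (≡-trans (d-++ u P K) (≡-trans (cong (d u P +_) (end-no-nbr St Pu uv mK len)) (+-identityʳ _)))
            (subst (λ q → q + suc β ≤ _) (Σα (reqs (valid′ St))) (degree-sum u (valid′ St)))
            (end-close (valid′ St) (λ f → refl) Pu)

        last-degree : ∀ {F P K u v} → State F (P ++ K) → Path u P v → side u ≢ side v → Matched K → length P ≡ ℓ →
                      suc (sumᴸ reqs₀) ≤ SF (nb v) F
        last-degree {P = P} {K} St Pu uv mK len =
          end-degree (state-≈ (++-congˡ {P} {reverse P} K (reverse-≈ P)) St) (path-reverse Pu) (uv ∘ ≡-sym) mK (≡-trans (length-reverse P) len)

        flip-one : ∀ {C a b c} → One C a b c → One C a c b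
        flip-one o z₁ z₂ z₃ z₄ L cl e h₁ h₂ h₃ h₄ = o z₁ z₂ z₃ z₄ L cl e h₁ h₂ h₄ h₃

        ΣF-six : ∀ (f₁ f₂ f₃ f₄ f₅ f₆ : ℕ × List V → ℕ) F →
                 ΣF (λ e → f₁ e + f₂ e + f₃ e + f₄ e + f₅ e + f₆ e) F ≡ ΣF f₁ F + ΣF f₂ F + ΣF f₃ F + ΣF f₄ F + ΣF f₅ F + ΣF f₆ F
        ΣF-six f₁ f₂ f₃ f₄ f₅ f₆ F =
          ≡-trans (ΣF-+ (λ e → f₁ e + f₂ e + f₃ e + f₄ e + f₅ e) f₆ F) (cong (_+ ΣF f₆ F)
          (≡-trans (ΣF-+ (λ e → f₁ e + f₂ e + f₃ e + f₄ e) f₅ F) (cong (_+ ΣF f₅ F)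
          (≡-trans (ΣF-+ (λ e → f₁ e + f₂ e + f₃ e) f₄ F) (cong (_+ ΣF f₄ F)
          (≡-trans (ΣF-+ (λ e → f₁ e + f₂ e) f₃ F) (cong (_+ ΣF f₃ F) (ΣF-+ f₁ f₂ F))))))))

        -- Three states share the inner path `core`: the given one, and those where `u` has replaced
        -- `x` or `v` has replaced `y` on `C`. Each of the six vertices is an end of the longest
        -- path in one of them and is counted there, so the counts on the changed cycle refer to
        -- `C`, to `u ∷ L` or to `v ∷ M`.
        hub : ∀ {α C F K u p core w v x L a b y M a' b'} →
              State ((α , C) ∷ F) ((u ∷ (core ++ v ∷ [])) ++ K) → u ~ p → Path p core w → w ~ v → side u ≢ side v →
              Matched K → length (u ∷ (core ++ v ∷ [])) ≡ ℓ → 2 * suc β ≤ ℓ →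
              length C ≡ 2 * suc α → suc (2 * α) ≤ d u C + d v C →
              C ≈ x ∷ L → Path a L b → u ~ a → b ~ u → v ~ x →
              C ≈ y ∷ M → Path a' M b' → v ~ a' → b' ~ v → u ~ y → ⊥
        hub {α} {C} {F} {K} {u} {p} {core} {w} {v} {x} {L} {a} {b} {y} {M}
            S₀ up Pc wv uv mK len big exactC heavyC eL PL ua bu vx eM PM va bv uy =
          <-irrefl refl (ends-arith {sumᴸ reqs₀} {α} {ΣF proj₁ F} {d u C} {d v C} {d p (u ∷ L)} {d w (v ∷ M)} {d x (u ∷ L)} {d y (v ∷ M)}
              {SF (nb u) F} {SF (nb v) F} {SF (nb p) F} {SF (nb w) F} {SF (nb x) F} {SF (nb y) F} (Σα {(α , C) ∷ F} (reqs (valid′ S₀)))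
            (end-degree S₀ (up ∷ path-u) uv mK len) (end-degree S₀′ (~-sym wv ∷ path-v) (uv ∘ ≡-sym) mK len₀′)
            (last-degree S₁ (~-sym vx ∷ path-x) xp mK len₁) (last-degree S₂ (~-sym uy ∷ path-y) yw mK len₂)
            (end-degree S₁ (~-sym vx ∷ path-x) xp mK len₁) (end-degree S₂ (~-sym uy ∷ path-y) yw mK len₂)
            others centre)
          where
          rc = reverse core
          path-u : Path p (core ++ v ∷ []) v
          path-u = path-∷ʳ Pc wv
          path-v : Path w (rc ++ u ∷ []) u
          path-v = path-∷ʳ (path-reverse Pc) (~-sym up)
          path-x : Path v (v ∷ rc) p
          path-x = ~-sym wv ∷ path-reverse Pc
          path-y : Path u (u ∷ core) w
          path-y = up ∷ Pc
          xp : side x ≢ side p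
          xp q = bip up (≡-trans (≢-≢⇒≡ uv (bip vx)) q)
          yw : side y ≢ side w
          yw q = bip (~-sym wv) (≡-trans (≢-≢⇒≡ (uv ∘ ≡-sym) (bip uy)) q)
          len-core : suc (suc (length core)) ≡ ℓ
          len-core = ≡-trans (cong suc (≡-trans (+-comm 1 (length core)) (≡-sym (length-++ core)))) len
          len₀′ : length (v ∷ (rc ++ u ∷ [])) ≡ ℓ
          len₀′ = ≡-trans (cong suc (≡-trans (length-++ rc) (≡-trans (+-comm (length rc) 1) (cong suc (length-reverse core))))) len-core
          len₁ : length (x ∷ (v ∷ rc)) ≡ ℓ
          len₁ = ≡-trans (cong (λ t → suc (suc t)) (length-reverse core)) len-core
          len₂ : length (y ∷ (u ∷ core)) ≡ ℓ
          len₂ = len-core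
          mv₀ : ∀ f → f u + S f ((core ++ v ∷ []) ++ K) ≡ f v + S f ((rc ++ u ∷ []) ++ K)
          mv₀ f = ≡-trans (cong (f u +_) (≡-trans (S-++ f (core ++ v ∷ []) K) (cong (_+ S f K) (S-∷ʳ f core v))))
            (≡-trans (ar (f u) (f v) (S f core) (S f K))
            (≡-sym (cong (f v +_) (≡-trans (S-++ f (rc ++ u ∷ []) K) (cong (_+ S f K) (≡-trans (S-∷ʳ f rc u) (cong (f u +_) (S-reverse f core))))))))
            where
            ar : ∀ a b c e → a + ((b + c) + e) ≡ b + ((a + c) + e)
            ar = solve-∀
          mv₁ : x ∷ ((core ++ v ∷ []) ++ K) ≈ (x ∷ (v ∷ rc)) ++ K
          mv₁ f = cong (f x +_) (≡-trans (≡-trans (S-++ f (core ++ v ∷ []) K) (cong (_+ S f K) (S-∷ʳ f core v)))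
            (≡-trans (+-assoc (f v) _ _) (cong (f v +_) (≡-sym (≡-trans (S-++ f rc K) (cong (_+ S f K) (S-reverse f core)))))))
          mv₂ : y ∷ ((rc ++ u ∷ []) ++ K) ≈ (y ∷ (u ∷ core)) ++ K
          mv₂ f = cong (f y +_) (≡-trans (≡-trans (S-++ f (rc ++ u ∷ []) K) (cong (_+ S f K) (≡-trans (S-∷ʳ f rc u) (cong (f u +_) (S-reverse f core)))))
            (≡-trans (+-assoc (f u) _ _) (cong (f u +_) (≡-sym (S-++ f core K)))))
          S₀′ : State ((α , C) ∷ F) ((v ∷ (rc ++ u ∷ [])) ++ K)
          S₀′ = state-≈ mv₀ S₀
          S₁ : State ((α , u ∷ L) ∷ F) ((x ∷ (v ∷ rc)) ++ K)
          S₁ = state-≈ mv₁ (swap-in {R' = (core ++ v ∷ []) ++ K} S₀ (λ f → refl) eL PL ua bu)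
          S₂ : State ((α , v ∷ M) ∷ F) ((y ∷ (u ∷ core)) ++ K)
          S₂ = state-≈ mv₂ (swap-in {R' = (rc ++ u ∷ []) ++ K} S₀′ (λ f → refl) eM PM va bv)
          u∈ = ∈ₘ-++ˡ {u} {u ∷ (core ++ v ∷ [])} K (path-first (up ∷ path-u))
          v∈ = ∈ₘ-++ˡ {v} {v ∷ (rc ++ u ∷ [])} K (path-first (~-sym wv ∷ path-v))
          x∈ = ∈ₘ-++ˡ {x} {x ∷ (v ∷ rc)} K (path-first (~-sym vx ∷ path-x))
          p∈ = ∈ₘ-++ˡ {p} {x ∷ (v ∷ rc)} K (path-last (~-sym vx ∷ path-x))
          y∈ = ∈ₘ-++ˡ {y} {y ∷ (u ∷ core)} K (path-first (~-sym uy ∷ path-y))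
          w∈ = ∈ₘ-++ˡ {w} {y ∷ (u ∷ core)} K (path-last (~-sym uy ∷ path-y))
          2≤ : 2 ≤ α
          2≤ = 2≤α (valid′ S₀)
          big′ : ∀ {l} → l ≡ ℓ → 2 * suc β ≤ l
          big′ e = subst (2 * suc β ≤_) (≡-sym e) big
          six-edges : ℕ × List V → ℕ
          six-edges (_ , D) = d u D + d v D + d p D + d w D + d x D + d y D

          -- `D` is a cycle of all three states, so the exclusions from all three paths hold on it.
          -- If `D` is longer than required, `small` bounds each vertex separately.
          other : ∀ e F' → F ↭ e ∷ F' → six-edges e ≤ 6 * proj₁ e
          other (δ , D) F' perm = bound (length D ≟ 2 * suc δ)
            where
            st : ∀ {B R} → State ((α , B) ∷ F) R → State ((δ , D) ∷ (α , B) ∷ F') R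
            st = state-↭ (trans (prep _ perm) (swap _ _ ↭-refl))
            σ : Six D u v p w x y
            σ = record
              { uv = uv ; up = bip up ; vw = bip (~-sym wv) ; vx = bip vx ; uy = bip uy
              ; u-pv = state-one (valid′ (st S₀)) path-u (big′ len)
              ; v-wu = state-one (valid′ (st S₀′)) path-v (big′ len₀′)
              ; x-pv = flip-one {D} (state-one (valid′ (st S₁)) path-x (big′ len₁))
              ; y-wu = flip-one {D} (state-one (valid′ (st S₂)) path-y (big′ len₂))
              ; xpwv = state-two (valid′ (st S₁)) (~-sym vx) (path-reverse Pc) (big′ len₁)
              ; ywpu = state-two (valid′ (st S₂)) (~-sym uy) Pc (big′ len₂) }
            bound : Dec (length D ≡ 2 * suc δ) → six-edges (δ , D) ≤ 6 * δ
            bound (yes e) = six-bound σ (proj₁ (good₁ (valid′ (st S₀)))) e (2≤α (valid′ (st S₀)))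
            bound (no ne) = ≤-trans (+-mono-≤ (+-mono-≤ (+-mono-≤ (+-mono-≤ (+-mono-≤
                (cut-down (small (st S₀) u∈)) (cut-down (small (st S₀′) v∈))) (cut-down (small (st S₁) p∈))) (cut-down (small (st S₂) w∈)))
                (cut-down (small (st S₁) x∈))) (cut-down (small (st S₂) y∈))) (≤-reflexive (six-times δ))
              where
              cut-down : ∀ {k} → k ≤ δ ⊎ (k ≤ suc δ × length D ≡ 2 * suc δ) → k ≤ δ
              cut-down (inj₁ h)       = h
              cut-down (inj₂ (_ , e)) = ⊥-elim (ne e)

          others : SF (nb u) F + SF (nb v) F + SF (nb p) F + SF (nb w) F + SF (nb x) F + SF (nb y) F ≤ 6 * ΣF proj₁ F
          others = subst₂ _≤_ (ΣF-six _ _ _ _ _ _ F) (ΣF-scale 6 proj₁ F) (ΣF-mono F other)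

          du = small≤ S₀ u∈
          dv = small≤ S₀′ v∈
          centre : d u C + d v C + d p (u ∷ L) + d w (v ∷ M) + d x (u ∷ L) + d y (v ∷ M) ≤ 5 + 6 * α
          centre with suc (suc (2 * α)) ≤? d u C + d v C
          ... | no  h = centre-arith₁ (d u C) (d v C) (d p (u ∷ L)) (d w (v ∷ M)) (d x (u ∷ L)) (d y (v ∷ M)) α
                 (≤-pred (≰⇒> h)) (small≤ S₁ p∈) (small≤ S₂ w∈) (small≤ S₁ x∈) (small≤ S₂ y∈)
          -- Here `u` and `v` are adjacent to every vertex of `C` on the side opposite to them. Then
          -- `p` has no neighbour on `C`, and on `u ∷ L` at most `u`.
          ... | yes h = centre-arith₂ (d u C) (d v C) (d p (u ∷ L)) (d w (v ∷ M)) (d x (u ∷ L)) (d y (v ∷ M)) α 2≤ du dv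
                (hub-arith (d u C) (d v C) (d p C) α (length C) (nb p x) (nb p u) (d p L) exactC (eL (nb p))
                  (one-bound (proj₁ (good₁ (valid′ S₀))) (len4 (valid′ S₀)) (bip up) uv (state-one (valid′ S₀) path-u (big′ len)))
                  (≤-trans (≤-reflexive (double-suc α)) h) dv (nb≤1 p u))
                (small≤ S₂ w∈) (small≤ S₁ x∈) (small≤ S₂ y∈)

        data Split (u v : V) : List V → Set where
          split : ∀ {p core w} → u ~ p → Path p core w → w ~ v → Split u v (u ∷ (core ++ v ∷ []))

        split-path : ∀ {u P v} → Path u P v → 3 ≤ length P → Split u v P
        split-path [ _ ]    (s≤s ())
        split-path (x ∷ Pp) h with path-unsnoc Pp
        split-path (x ∷ Pp) (s≤s (s≤s ())) | [] , refl , []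
        ... | M , refl , cut PM e = split x PM e

        -- The surplus of the two ends makes some cycle heavy for them, and `find-swap` applies to
        -- it in both directions: `x` can give way to `u` and is adjacent to `v`, `y` can give way
        -- to `v` and is adjacent to `u`.
        long-path : ∀ {F P K u v} → State F (P ++ K) → Path u P v → side u ≢ side v → Matched K → length P ≡ ℓ → 2 * suc β ≤ ℓ → ⊥
        long-path {F} {P} {K} {u} {v} St Pu uv mK len big
          with split-path Pu (≤-trans (≤-trans (s≤s (s≤s (s≤s z≤n))) (2 ⋆ s≤s 2≤β)) (≤-trans big (≤-reflexive (≡-sym len))))
        ... | split {core = core} up Pc wv =
          heavy (valid′ St) u v (double-arith (end-degree St Pu uv mK len) (last-degree St Pu uv mK len))
            λ α C F' perm h →
              let St' = state-↭ perm St
                  cyc = proj₁ (good₁ (valid′ St'))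
                  u∈ = ∈ₘ-++ˡ {u} {P} K (path-first Pu)
                  v∈ = ∈ₘ-++ˡ {v} {P} K (path-last Pu)
                  exactC = exact St' u∈ St' v∈ h
                  swap-uv = find-swap u v uv cyc exactC (2≤α (valid′ St')) (small≤ St' u∈) (small≤ St' v∈) h
                  swap-vu = find-swap v u (uv ∘ ≡-sym) cyc exactC (2≤α (valid′ St')) (small≤ St' v∈) (small≤ St' u∈)
                              (≤-trans h (≤-reflexive (+-comm (d u C) (d v C))))
              in swap-uv λ x L a b eL PL ua bu vx → swap-vu λ y M a' b' eM PM va bv uy →
                   hub St' up Pc wv uv mK len big exactC h eL PL ua bu vx eM PM va bv uy

      longest-path : ∀ {F P K u v} → State F (P ++ K) → Path u P v → side u ≢ side v → Matched K →
                     (∀ F' P' K' u' v' → State F' (P' ++ K') → Path u' P' v' → side u' ≢ side v' → Matched K' → length P < length P' → ⊥) → ⊥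
      longest-path {P = P} St Pu uv mK nl = long-path St Pu uv mK refl (long St refl Pu uv mK (rest-long St))
        where open Longest (length P) nl

      path-length : ∀ {F} P {K} → State F (P ++ K) → length P ≤ total
      path-length P {K} St = ≤-trans (m≤m+n (length P) (length K)) (≤-trans (≤-reflexive (≡-sym (length-++ P))) (rest-length St))

      no-path : ∀ n {F P K u v} → State F (P ++ K) → Path u P v → side u ≢ side v → Matched K → total ≤ n + length P → ⊥
      no-path zero St Pu uv mK fuel = longest-path St Pu uv mK
        λ F' P' K' u' v' St' Pu' uv' mK' l → <-irrefl refl (≤-trans l (≤-trans (path-length P' St') fuel))
      no-path (suc n) {P = P} St Pu uv mK fuel = longest-path St Pu uv mK
        λ F' P' K' u' v' St' Pu' uv' mK' l → no-path n St' Pu' uv' mK'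
          (≤-trans fuel (≤-trans (≤-reflexive (≡-sym (+-suc n (length P)))) (+-monoʳ-≤ n l)))

      no-matching : ∀ {F R} → State F R → Matched R → ⊥
      no-matching St []               with () ← rest-long St
      no-matching St (pair {y = y} e m) = no-path total St (e ∷ [ y ]) (bip e) m (m≤m+n total 2)

      -- A perfect matching of the rest

      module Unmatched (N : ℕ) (noBetter : ∀ F K U → State F (K ++ U) → Matched K → length U < N → ⊥) where

        -- T and T' are alternating paths that start at unmatched vertices s₁ and s₁'; shifting the
        -- matching along them makes e and e' the unmatched vertices.
        record Tails (F : Fam) (T T' K U : List V) (e s₁ e' s₁' : V) : Set where
          field
            St  : State F (T ++ (T' ++ (K ++ U)))
            PT  : Path e T s₁
            PT' : Path e' T' s₁'
            es  : side e ≡ side s₁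
            es' : side e' ≡ side s₁'
            ee' : side e ≢ side e'
            mK  : Matched K
            U<  : suc (length U) < N

        swap-tails : ∀ {F T T' K U e s₁ e' s₁'} → Tails F T T' K U e s₁ e' s₁' → Tails F T' T K U e' s₁' e s₁
        swap-tails {F} {T} {T'} {K} {U} t = record
          { St = state-≈ mv St ; PT = PT' ; PT' = PT ; es = es' ; es' = es ; ee' = ee' ∘ ≡-sym ; mK = mK ; U< = U< }
          where
          open Tails t
          mv : T ++ (T' ++ (K ++ U)) ≈ T' ++ (T ++ (K ++ U))
          mv f = ≡-trans (≡-trans (S-++ f T _) (cong (S f T +_) (S-++ f T' _)))
            (≡-trans (+-left-comm (S f T) (S f T') (S f (K ++ U))) (≡-sym (≡-trans (S-++ f T' _) (cong (S f T' +_) (S-++ f T _)))))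

        NoLongerTails : ℕ → Set
        NoLongerTails n = ∀ {F T T' K U e s₁ e' s₁'} → Tails F T T' K U e s₁ e' s₁' → n < length T + length T' → ⊥

        S-four : ∀ f T T' K U → S f (T ++ (T' ++ (K ++ U))) ≡ S f T + (S f T' + (S f K + S f U))
        S-four f T T' K U = ≡-trans (S-++ f T _) (cong (S f T +_) (≡-trans (S-++ f T' _) (cong (S f T' +_) (S-++ f K U))))

        zero-or : ∀ n → (1 ≤ n → ⊥) → n ≡ 0
        zero-or zero    h = refl
        zero-or (suc n) h = ⊥-elim (h (s≤s z≤n))

        -- A neighbour of `e` in `K` would lengthen `T`; one in `U` or on `T'` would give a larger
        -- matching. So the neighbours of `e` in the rest lie on `T`, where `end-close` counts at
        -- most β.
        low-tail : ∀ {F T T' K U e s₁ e' s₁'} → Tails F T T' K U e s₁ e' s₁' → NoLongerTails (length T + length T') →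
                   d e (T ++ (T' ++ (K ++ U))) ≤ β
        low-tail {F} {T} {T'} {K} {U} {e} {s₁} {e'} {s₁'} t nl = subst (_≤ β) (≡-sym
            (≡-trans (S-four (nb e) T T' K U) (≡-trans (cong₂ (λ a b → d e T + (a + b)) dT' (cong₂ _+_ dK dU)) (+-identityʳ _))))
            (end-close (valid′ St) (λ f → refl) PT)
          where
          open Tails t
          dK : d e K ≡ 0
          dK = zero-or _ λ h → go (matched-nbr e mK h)
            where
            go : _ → ⊥
            go (z , z' , M , ez , zz' , mM , eq) = nl {T = z' ∷ z ∷ T} {T'} {M} {U} record
              { St = state-≈ mv St ; PT = ~-sym zz' ∷ (~-sym ez ∷ PT) ; PT' = PT'
              ; es = ≡-trans (≡-sym (≢-≢⇒≡ (bip ez) (bip zz'))) es ; es' = es'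
              ; ee' = λ q → ee' (≡-trans (≢-≢⇒≡ (bip ez) (bip zz')) q) ; mK = mM ; U< = U< }
              (s≤s (n≤1+n _))
              where
              ar : ∀ a b z z' m u → a + (b + ((z + (z' + m)) + u)) ≡ z' + (z + (a + (b + (m + u))))
              ar = solve-∀
              mv : T ++ (T' ++ (K ++ U)) ≈ (z' ∷ z ∷ T) ++ (T' ++ (M ++ U))
              mv f = ≡-trans (S-four f T T' K U) (≡-trans (cong (λ k → S f T + (S f T' + (k + S f U))) (eq f))
                (≡-trans (ar (S f T) (S f T') (f z) (f z') (S f M) (S f U)) (cong (λ k → f z' + (f z + k)) (≡-sym (S-four f T T' M U)))))
          dU : d e U ≡ 0
          dU = zero-or _ λ h → go (find (adj e) U h) (path-unsnoc PT')
            where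
            go : (∃ λ A → ∃ λ w → ∃ λ B → U ≡ A ++ w ∷ B × e ~ w) → (∃ λ M → T' ≡ M ++ s₁' ∷ [] × Front e' M s₁') → ⊥
            go (A , w , B , refl , ew) (M , refl , fr) = noBetter F ((w ∷ T) ++ (M ++ K)) (s₁' ∷ (A ++ B)) (state-≈ mv St)
              (matched-++ (path-matched (~-sym ew ∷ PT) (λ q → bip ew (≡-trans es (≡-sym q))))
                (matched-++ (front-matched fr es') mK))
              (subst (_< N) (≡-trans (length-++ A) (≡-trans (+-suc (length A) (length B)) (cong suc (≡-sym (length-++ A))))) (≤-trans (n≤1+n _) U<))
              where
              ar : ∀ t m s k a w b → t + ((s + m) + (k + (a + (w + b)))) ≡ (w + (t + (m + k))) + (s + (a + b))
              ar = solve-∀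
              mv : T ++ ((M ++ s₁' ∷ []) ++ (K ++ (A ++ w ∷ B))) ≈ ((w ∷ T) ++ (M ++ K)) ++ (s₁' ∷ (A ++ B))
              mv f = ≡-trans (≡-trans (S-four f T (M ++ s₁' ∷ []) K _)
                  (cong₂ (λ a b → S f T + (a + (S f K + b))) (S-∷ʳ f M s₁') (S-++ f A (w ∷ B))))
                (≡-trans (ar (S f T) (S f M) (f s₁') (S f K) (S f A) (f w) (S f B))
                (≡-sym (≡-trans (S-++ f ((w ∷ T) ++ (M ++ K)) _)
                  (cong₂ (λ a b → (f w + a) + (f s₁' + b)) (≡-trans (S-++ f T _) (cong (S f T +_) (S-++ f M K))) (S-++ f A B)))))
          dT' : d e T' ≡ 0
          dT' = zero-or _ λ h → go (first-nbr e PT' h)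
            where
            go : (∃ λ A → ∃ λ B → ∃ λ z → T' ≡ A ++ B × Path z B s₁' × e ~ z × d e A ≡ 0 × Front e' A z) → ⊥
            go (A , B , z , refl , PB , ez , _ , fr) = noBetter F ((reverse T ++ B) ++ (A ++ K)) U (state-≈ mv St)
              (matched-++ (path-matched (path-++ (path-reverse PT) ez PB) (λ q → ee' (≡-trans es (≡-trans q (≡-sym es')))))
                (matched-++ (front-matched fr (≢-≢⇒≡ (ee' ∘ ≡-sym) (bip ez))) mK))
              (≤-trans (n≤1+n _) U<)
              where
              ar : ∀ t a b k u → t + ((a + b) + (k + u)) ≡ ((t + b) + (a + k)) + u
              ar = solve-∀
              mv : T ++ ((A ++ B) ++ (K ++ U)) ≈ ((reverse T ++ B) ++ (A ++ K)) ++ U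
              mv f = ≡-trans (≡-trans (S-four f T (A ++ B) K U) (cong (λ a → S f T + (a + (S f K + S f U))) (S-++ f A B)))
                (≡-trans (ar (S f T) (S f A) (S f B) (S f K) (S f U))
                (≡-sym (≡-trans (S-++ f ((reverse T ++ B) ++ (A ++ K)) U) (cong (_+ S f U)
                  (≡-trans (S-++ f (reverse T ++ B) _) (cong₂ _+_ (≡-trans (S-++ f (reverse T) B) (cong (_+ S f B) (S-reverse f T))) (S-++ f A K)))))))

        -- `e` is exchanged for a neighbour `z` of `e'`. Then `T` without `e` and `z ∷ T'` are
        -- matched, and only `U` stays unmatched.
        longest-tails : ∀ {F T T' K U e s₁ e' s₁'} → Tails F T T' K U e s₁ e' s₁' → NoLongerTails (length T + length T') → ⊥
        longest-tails {F} {T} {T'} {K} {U} {e} {s₁} {e'} {s₁'} t nl = go PT refl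
          where
          open Tails t
          low-e : d e (T ++ (T' ++ (K ++ U))) ≤ β
          low-e = low-tail t nl
          low-e' : d e' (T ++ (T' ++ (K ++ U))) ≤ β
          low-e' = subst (_≤ β) (≡-trans (S-four (nb e') T' T K U) (≡-trans (+-left-comm (d e' T') (d e' T) (d e' K + d e' U)) (≡-sym (S-four (nb e') T T' K U))))
            (low-tail (swap-tails t) λ {_} {T₁} {T₂} t' l → nl t' (subst (_< length T₁ + length T₂) (+-comm (length T') (length T)) l))
          e'∈ : e' ∈ₘ (T ++ (T' ++ (K ++ U)))
          e'∈ with ∈ₘ-++ˡ {e'} {T'} (K ++ U) (path-first PT')
          ... | M , eq = T ++ M , λ f → ≡-trans (S-++ f T _) (≡-trans (cong (S f T +_) (eq f))
                  (≡-trans (+-left-comm (S f T) (f e') (S f M)) (cong (f e' +_) (≡-sym (S-++ f T M)))))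
          finish : ∀ {T₁} → T ≡ e ∷ T₁ → Matched T₁ → ⊥
          finish {T₁} refl m = exchange {R' = T₁ ++ (T' ++ (K ++ U))} St (λ f → refl) e'∈ ee'
            (≤-trans (+-mono-≤ low-e low-e') (≤-trans (≤-reflexive (cong (β +_) (≡-sym (+-identityʳ β)))) (n≤1+n _)))
            λ F' z e'z St' → noBetter F' ((z ∷ T') ++ (T₁ ++ K)) U (state-≈ (mv z) St')
              (matched-++ (path-matched (~-sym e'z ∷ PT') (λ q → bip e'z (≡-trans es' (≡-sym q)))) (matched-++ m mK))
              (≤-trans (n≤1+n _) U<)
            where
            ar : ∀ z t t' k u → z + (t + (t' + (k + u))) ≡ (z + (t' + (t + k))) + u
            ar = solve-∀
            mv : ∀ z → z ∷ (T₁ ++ (T' ++ (K ++ U))) ≈ ((z ∷ T') ++ (T₁ ++ K)) ++ U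
            mv z f = ≡-trans (cong (f z +_) (S-four f T₁ T' K U)) (≡-trans (ar (f z) (S f T₁) (S f T') (S f K) (S f U))
              (≡-sym (≡-trans (S-++ f ((z ∷ T') ++ (T₁ ++ K)) U) (cong (λ a → (f z + a) + S f U)
                (≡-trans (S-++ f T' _) (cong (S f T' +_) (S-++ f T₁ K)))))))
          go : ∀ {L} → Path e L s₁ → T ≡ L → ⊥
          go [ _ ]   eq = finish eq []
          go (x ∷ P) eq = finish eq (path-matched P (λ q → bip x (≡-trans es (≡-sym q))))

        tails-length : ∀ {F T T' K U e s₁ e' s₁'} → Tails F T T' K U e s₁ e' s₁' → length T + length T' ≤ total
        tails-length {F} {T} {T'} {K} {U} t = ≤-trans (≤-reflexive (≡-sym (length-++ T)))
          (path-length (T ++ T') {K ++ U} (state-≈ (λ f → cong (S f) (≡-sym (++-assoc T T' (K ++ U)))) (Tails.St t)))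

        no-tails : ∀ n {F T T' K U e s₁ e' s₁'} → Tails F T T' K U e s₁ e' s₁' → total ≤ n + (length T + length T') → ⊥
        no-tails zero t fuel = longest-tails t λ t' l → <-irrefl refl (≤-trans l (≤-trans (tails-length t') fuel))
        no-tails (suc n) t fuel = longest-tails t
          λ t' l → no-tails n t' (≤-trans fuel (≤-trans (≤-reflexive (≡-sym (+-suc n _))) (+-monoʳ-≤ n l)))

      -- Cycles and matching edges have equally many vertices on both sides, and so has the whole
      -- graph.
      balanced-rest : ∀ {F K U} r → State F (K ++ U) → Matched K → S (same r) U ≡ S (opp r) U
      balanced-rest {F} {K} {U} r St mK = +-cancelˡ-≡ (SF (opp r) F + S (opp r) K) _ _
        (≡-trans (cong₂ (λ a b → a + b + S (same r) U) (fam F (good Va) (All-resp-↭ (↭-sym (reqs Va)) 2≤reqs)) (≡-sym (mat mK)))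
        (≡-trans (total-of (same r)) (≡-trans (balanced r) (≡-sym (total-of (opp r))))))
        where
        Va = valid′ St
        total-of : ∀ f → SF f F + S f K + S f U ≡ tot f
        total-of f = ≡-trans (+-assoc (SF f F) _ _) (≡-trans (cong (SF f F +_) (≡-sym (S-++ f K U))) (cover Va f))
        mat : ∀ {K} → Matched K → S (same r) K ≡ S (opp r) K
        mat []                     = refl
        mat (pair {x} {y} {L} e m) = ≡-trans (≡-sym (+-assoc (same r x) _ _)) (≡-trans
          (cong₂ _+_ (≡-trans (same-~ r e) (≡-sym (opp-~ r e))) (mat m)) (+-assoc (opp r x) _ _))
        fam : ∀ F' → All Good F' → All (2 ≤_) (map proj₁ F') → SF (opp r) F' ≡ SF (same r) F'
        fam []             g              h       = refl
        fam ((α , C) ∷ F') ((c , le) ∷ g) (a ∷ h) = cong₂ _+_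
          (≡-sym (same≡opp r c (≤-trans (≤-trans (s≤s (s≤s (s≤s (s≤s z≤n)))) (2 ⋆ s≤s a)) le))) (fam F' g h)

      -- By balance there is an unmatched vertex on the other side of `a`; the two of them are the
      -- initial tails.
      no-unmatched : ∀ n {F K U} → State F (K ++ U) → Matched K → length U ≤ n → ⊥
      no-unmatched n {K = K} {[]} St mK h = no-matching (state-≈ (λ f → cong (S f) (++-identityʳ K)) St) mK
      no-unmatched (suc n) {F} {K} {a ∷ U} St mK (s≤s h) = go (find (λ z → side a xor side z) U opposite)
        where
        opposite : 1 ≤ S (opp a) U
        opposite = subst (1 ≤_) (≡-trans (balanced-rest a St mK) (cong (_+ S (opp a) U) (xor-≡ {side a} refl)))
          (≤-trans (≤-reflexive (≡-sym (same-self (side a)))) (m≤m+n (same a a) (S (same a) U)))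
          where
          same-self : ∀ b → b2n (not (b xor b)) ≡ 1
          same-self false = refl
          same-self true  = refl
        go : (∃ λ A → ∃ λ b → ∃ λ B → U ≡ A ++ b ∷ B × side a xor side b ≡ true) → ⊥
        go (A , b , B , refl , x) = no-tails total {T = a ∷ []} {b ∷ []} {K} {A ++ B} record
          { St = state-≈ mv St ; PT = [ a ] ; PT' = [ b ] ; es = refl ; es' = refl
          ; ee' = λ q → xor-absurd (side a) (subst (λ t → side a xor t ≡ true) (≡-sym q) x)
          ; mK = mK
          ; U< = s≤s (≤-reflexive (≡-sym (≡-trans (length-++ A) (≡-trans (+-suc (length A) (length B)) (cong suc (≡-sym (length-++ A))))))) }
          (m≤m+n total 2)
          where
          open Unmatched (suc (length (A ++ b ∷ B)))
            (λ F' K' U' St' mK' l → no-unmatched n St' mK' (≤-trans (≤-pred l) h))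
          xor-absurd : ∀ b → b xor b ≡ true → ⊥
          xor-absurd false ()
          xor-absurd true  ()
          ar : ∀ k a c b e → k + (a + (c + (b + e))) ≡ a + (b + (k + (c + e)))
          ar = solve-∀
          mv : K ++ (a ∷ (A ++ b ∷ B)) ≈ (a ∷ []) ++ ((b ∷ []) ++ (K ++ (A ++ B)))
          mv f = ≡-trans (≡-trans (S-++ f K _) (cong (λ t → S f K + (f a + t)) (S-++ f A (b ∷ B))))
            (≡-trans (ar (S f K) (f a) (S f A) (f b) (S f B))
            (cong (λ t → f a + (f b + t)) (≡-sym (≡-trans (S-++ f K _) (cong (S f K +_) (S-++ f A B))))))

    -- Induction on a bound for the size takes the place of choosing a smallest system; a smaller
    -- one only leaves more room for the missing cycle.
    search : ∀ n {F R} → Valid F R → size F + 2 * suc β ≤ total → size F ≤ n → ⊥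
    search zero {F} {R} V room h = no-unmatched (length R) {K = []} (state V refl) [] ≤-refl
      where open Level (size F) room (λ F' R' V' l → <-irrefl refl (≤-trans l (≤-trans h z≤n)))
    search (suc n) {F} {R} V room h = no-unmatched (length R) {K = []} (state V refl) [] ≤-refl
      where open Level (size F) room (λ F' R' V' l → search n V' (≤-trans (+-monoˡ-≤ _ (<⇒≤ l)) room) (≤-pred (≤-trans l h)))

-- Sums over all vertices and complements of vertex lists

totF : ∀ {m} → (Fin m → ℕ) → ℕ
totF {zero}  f = 0
totF {suc m} f = f zero + totF (f ∘ suc)

totF-cong : ∀ {m} {f g : Fin m → ℕ} → (∀ i → f i ≡ g i) → totF f ≡ totF g
totF-cong {zero}  h = refl
totF-cong {suc m} h = cong₂ _+_ (h zero) (totF-cong (h ∘ suc))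

totF-mono : ∀ {m} {f g : Fin m → ℕ} → (∀ i → f i ≤ g i) → totF f ≤ totF g
totF-mono {zero}  h = z≤n
totF-mono {suc m} h = +-mono-≤ (h zero) (totF-mono (h ∘ suc))

totF-0 : ∀ m → totF {m} (λ _ → 0) ≡ 0
totF-0 zero    = refl
totF-0 (suc m) = totF-0 m

totF-count : ∀ {m} (q : Fin m → Bool) → totF (b2n ∘ q) ≡ countF q
totF-count {zero}  q = refl
totF-count {suc m} q with q zero
... | true  = cong suc (totF-count (q ∘ suc))
... | false = totF-count (q ∘ suc)

δ : ∀ {m} → Fin m → Fin m → ℕ
δ v z = b2n (does (v Fin.≟ z))

totF-δ : ∀ {m} (v : Fin m) → totF (δ v) ≡ 1
totF-δ {suc m} zero    = cong suc (totF-0 m)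
totF-δ {suc m} (suc v) = totF-δ v

δ-self : ∀ {m} (v : Fin m) → δ v v ≡ 1
δ-self v = cong b2n (dec-true (v Fin.≟ v) refl)

module _ {m : ℕ} where

  open ListSums {Fin m}

  S-tabulate : ∀ {n} f (g : Fin n → Fin m) → S f (tabulate g) ≡ totF (f ∘ g)
  S-tabulate {zero}  f g = refl
  S-tabulate {suc n} f g = cong (f (g zero) +_) (S-tabulate f (g ∘ suc))

  find-vertex : ∀ (v : Fin m) L → 1 ≤ S (δ v) L → ∃ λ A → ∃ λ B → L ≡ A ++ v ∷ B
  find-vertex v (x ∷ L) h with v Fin.≟ x
  ... | yes refl = [] , L , refl
  ... | no _ with find-vertex v L h
  ...   | A , B , refl = x ∷ A , B , refl

  -- The vertices of `L` are taken out of the list of all vertices one by one. Each is still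
  -- present, since its total weight is 1 and the part of `L` already treated does not contain it.
  complement : ∀ L → (∀ v → S (δ v) L ≤ 1) → ∃ λ R → ∀ f → S f L + S f R ≡ totF f
  complement []      h = allFin m , λ f → S-tabulate f id
  complement (v ∷ L) h with complement L (λ w → ≤-trans (m≤n+m (S (δ w) L) (δ w v)) (h w))
  ... | R , eq with find-vertex v R v∈R
    where
    v∉L : S (δ v) L ≡ 0
    v∉L = n≤0⇒n≡0 (≤-pred (subst (λ t → t + S (δ v) L ≤ 1) (δ-self v) (h v)))
    v∈R : 1 ≤ S (δ v) R
    v∈R = ≤-reflexive (≡-sym (≡-trans (cong (_+ S (δ v) R) (≡-sym v∉L)) (≡-trans (eq (δ v)) (totF-δ v))))
  ...   | A , B , refl = A ++ B , λ f → ≡-trans (cong (f v + S f L +_) (S-++ f A B))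
            (≡-trans (mv (f v) (S f L) (S f A) (S f B)) (≡-trans (cong (S f L +_) (≡-sym (S-++ f A (v ∷ B)))) (eq f)))
    where
    mv : ∀ v l a b → v + l + (a + b) ≡ l + (a + (v + b))
    mv = solve-∀

-- `side` is a parameter because graphs with different edges over one bipartition get compared.
record Bipartite {m : ℕ} (side : Fin m → Bool) : Set where
  field
    edge     : Fin m → Fin m → Bool
    edge-sym : ∀ u v → edge u v ≡ edge v u
    edge-bip : ∀ {u v} → edge u v ≡ true → side u ≢ side v
open Bipartite

module Fams {m} {side : Fin m → Bool} (G : Bipartite side) = Families side (edge G) (edge-sym G) (edge-bip G)

-- From the complete bipartite graph down to G, one edge at a time

module Target {m : ℕ} (side : Fin m → Bool) (αs : List ℕ) (2≤αs : All (2 ≤_) αs)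
              (balanced : countF side ≡ countF (not ∘ side)) where

  -- `once` says both that the cycles are disjoint and that none of them repeats a vertex.
  record Success (G : Bipartite side) : Set where
    open Fams G
    field
      fam     : Fam
      indices : map proj₁ fam ↭ αs
      goods   : All Good fam
      once    : ∀ v → SF (δ v) fam ≤ 1

  Dense : Bipartite side → Set
  Dense G = ∀ u → suc (sumᴸ αs) ≤ totF (b2n ∘ edge G u)

  balance : ∀ u → totF (λ z → b2n (not (side u xor side z))) ≡ totF (λ z → b2n (side u xor side z))
  balance u with side u
  ... | false = ≡-trans (totF-count (not ∘ side)) (≡-trans (≡-sym balanced) (≡-sym (totF-count side)))
  ... | true  = ≡-trans (totF-cong (λ z → cong b2n (Bool.not-involutive (side z))))
                  (≡-trans (totF-count side) (≡-trans balanced (≡-sym (totF-count (not ∘ side)))))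

  -- If adding the edge xy creates the family, then at most one of its cycles uses xy.
  module Remove (G G⁺ : Bipartite side) (x : Fin m)
                (new : ∀ {u v} → edge G⁺ u v ≡ true → edge G u v ≡ true ⊎ (u ≡ x ⊎ v ≡ x))
                (dense : Dense G) where

    module H = Fams G
    module H⁺ = Fams G⁺
    open H

    away : ∀ {v} → v ≡ x → δ x v ≡ 0 → ⊥
    away refl z with () ← ≡-trans (≡-sym z) (δ-self x)

    head-0 : ∀ {a L b} → H⁺.Path a L b → S (δ x) L ≡ 0 → δ x a ≡ 0
    head-0 H⁺.[ a ]        z = m+n≡0⇒m≡0 (δ x a) z
    head-0 {a} (_ H⁺.∷ P) z = m+n≡0⇒m≡0 (δ x a) z

    last-0 : ∀ {a L b} → H⁺.Path a L b → S (δ x) L ≡ 0 → δ x b ≡ 0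
    last-0 H⁺.[ a ]        z = m+n≡0⇒m≡0 (δ x a) z
    last-0 {a} (_ H⁺.∷ P) z = last-0 P (m+n≡0⇒n≡0 (δ x a) z)

    old-edge : ∀ {u v} → edge G⁺ u v ≡ true → δ x u ≡ 0 → δ x v ≡ 0 → edge G u v ≡ true
    old-edge e zu zv with new e
    ... | inj₁ e'        = e'
    ... | inj₂ (inj₁ q) = ⊥-elim (away q zu)
    ... | inj₂ (inj₂ q) = ⊥-elim (away q zv)

    old-path : ∀ {a L b} → H⁺.Path a L b → S (δ x) L ≡ 0 → Path a L b
    old-path H⁺.[ a ]        z = [ a ]
    old-path {a} (e H⁺.∷ P) z =
      old-edge e (m+n≡0⇒m≡0 (δ x a) z) (head-0 P (m+n≡0⇒n≡0 (δ x a) z)) ∷ old-path P (m+n≡0⇒n≡0 (δ x a) z)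

    old-good : ∀ {e} → H⁺.Good e → S (δ x) (proj₂ e) ≡ 0 → Good e
    old-good ((a , b , P , e) , l) z = (a , b , old-path P z , old-edge e (last-0 P z) (head-0 P z)) , l

    old-fam : ∀ {F} → All H⁺.Good F → SF (δ x) F ≡ 0 → All Good F
    old-fam {[]}    []      z = []
    old-fam {e ∷ F} (g ∷ h) z =
      old-good g (m+n≡0⇒m≡0 (S (δ x) (proj₂ e)) z) ∷ old-fam h (m+n≡0⇒n≡0 (S (δ x) (proj₂ e)) z)

    -- The family visits `x` at most once, and only a cycle through `x` can use an edge that `G`
    -- lacks.
    split-fam : ∀ F → All H⁺.Good F → SF (δ x) F ≤ 1 →
                All Good F ⊎ ∃ λ β → ∃ λ B → ∃ λ F' → F ↭ (β , B) ∷ F' × 2 * suc β ≤ length B × All Good F'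
    split-fam []            []             h = inj₁ []
    split-fam ((α , C) ∷ F) (g@(_ , l) ∷ gs) h with S (δ x) C in eq
    ... | suc n = inj₂ (α , C , F , ↭-refl , l , old-fam gs (n≤0⇒n≡0 (≤-pred (≤-trans (s≤s (m≤n+m _ n)) h))))
    ... | zero with split-fam F gs h
    ...   | inj₁ hs = inj₁ (old-good g eq ∷ hs)
    ...   | inj₂ (β , B , F' , p , l' , hs) =
            inj₂ (β , B , (α , C) ∷ F' , trans (prep _ p) (swap _ _ ↭-refl) , l' , old-good g eq ∷ hs)

    flatten : Fam → List (Fin m)
    flatten []            = []
    flatten ((α , C) ∷ F) = C ++ flatten F

    S-flatten : ∀ f F → S f (flatten F) ≡ SF f F
    S-flatten f []            = refl
    S-flatten f ((α , C) ∷ F) = ≡-trans (S-++ f C (flatten F)) (cong (S f C +_) (S-flatten f F))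

    -- The vertices of the lost cycle `B` return to the rest and provide the room of 2 (β + 1)
    -- vertices with which `search` starts.
    remove : Success G⁺ → (Success G → ⊥) → ⊥
    remove σ ns with split-fam (Success.fam σ) (Success.goods σ) (Success.once σ x)
    ... | inj₁ gs = ns record { fam = Success.fam σ ; indices = Success.indices σ ; goods = gs ; once = Success.once σ }
    ... | inj₂ (β , B , F , p , l , gs)
      with complement (flatten ((β , B) ∷ F))
             (λ v → subst (_≤ 1) (≡-trans (ΣF-↭ _ p) (≡-sym (S-flatten (δ v) ((β , B) ∷ F)))) (Success.once σ v))
    ...   | R , all = search (size F) {F} {B ++ R} (valid ↭-refl gs cover′) room ≤-refl
      where
      perm : β ∷ map proj₁ F ↭ αs
      perm = trans (map⁺ proj₁ (↭-sym p)) (Success.indices σ)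
      total≡ : ∀ f → S f B + SF f F + S f R ≡ totF f
      total≡ f = ≡-trans (cong (_+ S f R) (≡-sym (S-flatten f ((β , B) ∷ F)))) (all f)
      2≤β : 2 ≤ β
      2≤β with All-resp-↭ (↭-sym perm) 2≤αs
      ... | h ∷ _ = h
      2≤F : All (2 ≤_) (map proj₁ F)
      2≤F with All-resp-↭ (↭-sym perm) 2≤αs
      ... | _ ∷ h = h
      dense′ : ∀ u → sumᴸ (map proj₁ F) + suc β ≤ totF (nb u)
      dense′ u = ≤-trans (≤-reflexive (≡-trans (+-suc _ β) (cong suc (≡-trans (+-comm _ β) (sum-↭ perm))))) (dense u)
      found : ∀ F' B' R' → map proj₁ F' ↭ map proj₁ F → All Good F' → Cyc B' → 2 * suc β ≤ length B' →
              (∀ f → SF f F' + (S f B' + S f R') ≡ totF f) → ⊥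
      found F' B' R' p' gs' c' l' t' = ns record
        { fam = (β , B') ∷ F' ; indices = trans (prep β p') perm ; goods = (c' , l') ∷ gs'
        ; once = λ v → ≤-trans (≤-trans (m≤m+n _ (S (δ v) R'))
                   (≤-reflexive (≡-trans (mv (S (δ v) B') (SF (δ v) F') (S (δ v) R')) (t' (δ v))))) (≤-reflexive (totF-δ v)) }
        where
        mv : ∀ a b c → a + b + c ≡ b + (a + c)
        mv = solve-∀
      open Search totF β (map proj₁ F) 2≤β 2≤F dense′ balance found
      cover′ : ∀ f → SF f F + S f (B ++ R) ≡ totF f
      cover′ f = ≡-trans (cong (SF f F +_) (S-++ f B R)) (≡-trans (mv (SF f F) (S f B) (S f R)) (total≡ f))
        where
        mv : ∀ a b c → a + (b + c) ≡ b + a + c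
        mv = solve-∀
      room : size F + 2 * suc β ≤ totF {m} (λ _ → 1)
      room = ≤-trans (≤-reflexive (+-comm (size F) _)) (≤-trans (+-monoˡ-≤ (size F) (≤-trans l (≤-reflexive (≡-sym (S-1 B)))))
               (≤-trans (m≤m+n _ (S (λ _ → 1) R)) (≤-reflexive (total≡ (λ _ → 1)))))

  joins : Fin m → Fin m → Fin m → Fin m → Bool
  joins x y u v = does (u Fin.≟ x) ∧ does (v Fin.≟ y)

  -- The factor `side x xor side y` makes a pair within one side add nothing, so all pairs can be
  -- added indiscriminately.
  new-edge : Fin m → Fin m → Fin m → Fin m → Bool
  new-edge x y u v = (side x xor side y) ∧ (joins x y u v ∨ joins x y v u)

  joins-true : ∀ {x y u v} → joins x y u v ≡ true → u ≡ x × v ≡ y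
  joins-true {x} {y} {u} {v} e with u Fin.≟ x | v Fin.≟ y
  ... | yes p | yes q = p , q
  joins-true () | yes _ | no _
  joins-true () | no _ | _

  new-edge-true : ∀ x y {u v} → new-edge x y u v ≡ true → side x ≢ side y × ((u ≡ x × v ≡ y) ⊎ (v ≡ x × u ≡ y))
  new-edge-true x y {u} {v} e with side x | side y | joins x y u v in j₁ | joins x y v u in j₂
  ... | true  | false | true  | _     = (λ ()) , inj₁ (joins-true {x} {y} j₁)
  ... | true  | false | false | true  = (λ ()) , inj₂ (joins-true {x} {y} j₂)
  ... | false | true  | true  | _     = (λ ()) , inj₁ (joins-true {x} {y} j₁)
  ... | false | true  | false | true  = (λ ()) , inj₂ (joins-true {x} {y} j₂)
  new-edge-true x y () | true  | false | false | false
  new-edge-true x y () | false | true  | false | false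
  new-edge-true x y () | true  | true  | _     | _
  new-edge-true x y () | false | false | _     | _

  ∨-true : ∀ {a b} → a ∨ b ≡ true → a ≡ true ⊎ b ≡ true
  ∨-true {true}  e = inj₁ e
  ∨-true {false} e = inj₂ e

  add : Fin m × Fin m → Bipartite side → Bipartite side
  add (x , y) G = record
    { edge     = λ u v → edge G u v ∨ new-edge x y u v
    ; edge-sym = λ u v → cong₂ _∨_ (edge-sym G u v) (cong ((side x xor side y) ∧_) (Bool.∨-comm (joins x y u v) (joins x y v u)))
    ; edge-bip = bip′ }
    where
    bip′ : ∀ {u v} → edge G u v ∨ new-edge x y u v ≡ true → side u ≢ side v
    bip′ {u} {v} e with ∨-true {edge G u v} e
    ... | inj₁ e' = edge-bip G e'
    ... | inj₂ e' with new-edge-true x y {u} {v} e'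
    ...   | ne , inj₁ (refl , refl) = ne
    ...   | ne , inj₂ (refl , refl) = ne ∘ ≡-sym

  adds : List (Fin m × Fin m) → Bipartite side → Bipartite side
  adds []      G = G
  adds (e ∷ E) G = add e (adds E G)

  dense-adds : ∀ E {G} → Dense G → Dense (adds E G)
  dense-adds []      d u = d u
  dense-adds (e ∷ E) {G} d u = ≤-trans (dense-adds E d u) (totF-mono λ z → b2n-∨ (edge (adds E G) u z) _)
    where
    b2n-∨ : ∀ a b → b2n a ≤ b2n (a ∨ b)
    b2n-∨ true  b = ≤-refl
    b2n-∨ false b = z≤n

  -- Every intermediate graph contains `G` and is therefore dense, as each removal requires.
  adds-success : ∀ E {G} → Dense G → Success (adds E G) → (Success G → ⊥) → ⊥
  adds-success []            d σ ns = ns σ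
  adds-success ((x , y) ∷ E) {G} d σ ns =
    Remove.remove (adds E G) (add (x , y) (adds E G)) x new (dense-adds E d) σ (λ σ' → adds-success E d σ' ns)
    where
    new : ∀ {u v} → edge (adds E G) u v ∨ new-edge x y u v ≡ true → edge (adds E G) u v ≡ true ⊎ (u ≡ x ⊎ v ≡ x)
    new {u} {v} e with ∨-true {edge (adds E G) u v} e
    ... | inj₁ e' = inj₁ e'
    ... | inj₂ e' with new-edge-true x y {u} {v} e'
    ...   | _ , inj₁ (q , _) = inj₂ (inj₁ q)
    ...   | _ , inj₂ (q , _) = inj₂ (inj₂ q)

  adds-edge : ∀ E {G x y} → (x , y) ∈ E → side x ≢ side y → edge (adds E G) x y ≡ true
  adds-edge ((x , y) ∷ E) {G} (here refl) ne = ∨-right (edge (adds E G) x y)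
    (cong₂ _∧_ (xor-true (side x) (side y) ne) (cong (_∨ joins x y y x) (cong₂ _∧_ (dec-true (x Fin.≟ x) refl) (dec-true (y Fin.≟ y) refl))))
    where
    ∨-right : ∀ a {b} → b ≡ true → a ∨ b ≡ true
    ∨-right a refl = Bool.∨-zeroʳ a
    xor-true : ∀ a b → a ≢ b → a xor b ≡ true
    xor-true false false ne = ⊥-elim (ne refl)
    xor-true false true  ne = refl
    xor-true true  false ne = refl
    xor-true true  true  ne = ⊥-elim (ne refl)
  adds-edge (e ∷ E) {G} {x} {y} (there i) ne = cong (_∨ new-edge (proj₁ e) (proj₂ e) x y) (adds-edge E i ne)

  module Complete (G : Bipartite side) (complete : ∀ {u v} → side u ≢ side v → edge G u v ≡ true) where

    open Fams G

    On : Bool → List (Fin m) → Set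
    On s = All (λ v → side v ≡ s)

    opposite : ∀ {u v} → side u ≡ true → side v ≡ false → u ~ v
    opposite p q = complete λ e → true≢false (≡-trans (≡-sym p) (≡-trans e q))
      where
      true≢false : true ≢ false
      true≢false ()

    record Take (k : ℕ) (xs ys : List (Fin m)) : Set where
      field
        {a b}    : Fin m
        {L}      : List (Fin m)
        {xs' ys'} : List (Fin m)
        path     : Path a L b
        a-side   : side a ≡ true
        b-side   : side b ≡ false
        len      : length L ≡ 2 * suc k
        xs-on    : On true xs'
        ys-on    : On false ys'
        xs-len   : length xs ≡ suc k + length xs'
        ys-len   : length ys ≡ suc k + length ys'
        sums     : ∀ f → S f L + (S f xs' + S f ys') ≡ S f xs + S f ys

    take : ∀ k xs ys → On true xs → On false ys → suc k ≤ length xs → suc k ≤ length ys → Take k xs ys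
    take zero (x ∷ xs) (y ∷ ys) (p ∷ ps) (q ∷ qs) _ _ = record
      { path = opposite p q ∷ [ y ] ; a-side = p ; b-side = q ; len = refl ; xs-on = ps ; ys-on = qs
      ; xs-len = refl ; ys-len = refl ; sums = λ f → mv (f x) (f y) (S f xs) (S f ys) }
      where
      mv : ∀ a b c e → a + (b + 0) + (c + e) ≡ (a + c) + (b + e)
      mv = solve-∀
    take (suc k) (x ∷ xs) (y ∷ ys) (p ∷ ps) (q ∷ qs) (s≤s h) (s≤s h') = record
      { path = opposite p q ∷ (~-sym (opposite t.a-side q) ∷ t.path) ; a-side = p ; b-side = t.b-side
      ; len = ≡-trans (cong (λ l → suc (suc l)) t.len) (≡-sym (double-suc (suc k)))
      ; xs-on = t.xs-on ; ys-on = t.ys-on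
      ; xs-len = cong suc t.xs-len ; ys-len = cong suc t.ys-len
      ; sums = λ f → ≡-trans (mv (f x) (f y) (S f t.L) _) (≡-trans (cong (f x + f y +_) (t.sums f)) (mv' (f x) (f y) (S f xs) (S f ys))) }
      where
      module t = Take (take k xs ys ps qs h h')
      mv : ∀ a b c e → a + (b + c) + e ≡ a + b + (c + e)
      mv = solve-∀
      mv' : ∀ a b c e → a + b + (c + e) ≡ (a + c) + (b + e)
      mv' = solve-∀

    -- A cycle with index `k` takes `suc k` vertices of each side, no matter which, so the sides can
    -- be used up greedily.
    build : ∀ γs xs ys → On true xs → On false ys → sumᴸ (map suc γs) ≤ length xs → sumᴸ (map suc γs) ≤ length ys →
            ∃ λ F → map proj₁ F ≡ γs × All Good F × ∃ λ R → ∀ f → SF f F + S f R ≡ S f xs + S f ys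
    build []       xs ys ps qs h h' = [] , refl , [] , xs ++ ys , λ f → S-++ f xs ys
    build (k ∷ γs) xs ys ps qs h h' =
      let F , e , g , R , eq = build γs t.xs' t.ys' t.xs-on t.ys-on
            (+-cancelˡ-≤ (suc k) _ _ (≤-trans h (≤-reflexive t.xs-len)))
            (+-cancelˡ-≤ (suc k) _ _ (≤-trans h' (≤-reflexive t.ys-len)))
      in (k , t.L) ∷ F , cong (k ∷_) e ,
         ((t.a , t.b , t.path , ~-sym (opposite t.a-side t.b-side)) , ≤-reflexive (≡-sym t.len)) ∷ g ,
         R , λ f → ≡-trans (+-assoc (S f t.L) _ _) (≡-trans (cong (S f t.L +_) (eq f)) (t.sums f))
      where
      module t = Take (take k xs ys ps qs (≤-trans (m≤m+n (suc k) _) h) (≤-trans (m≤m+n (suc k) _) h'))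

    record Sides (L : List (Fin m)) : Set where
      field
        {xs ys} : List (Fin m)
        xs-on   : On true xs
        ys-on   : On false ys
        xs-len  : length xs ≡ S (b2n ∘ side) L
        ys-len  : length ys ≡ S (b2n ∘ not ∘ side) L
        sums    : ∀ f → S f xs + S f ys ≡ S f L

    sides : ∀ L → Sides L
    sides []      = record { xs-on = [] ; ys-on = [] ; xs-len = refl ; ys-len = refl ; sums = λ f → refl }
    sides (x ∷ L) = put (side x) refl
      where
      module t = Sides (sides L)
      put : ∀ s → side x ≡ s → Sides (x ∷ L)
      put true  e = record { xs = x ∷ t.xs ; ys = t.ys ; xs-on = e ∷ t.xs-on ; ys-on = t.ys-on
        ; xs-len = cong₂ _+_ (≡-sym (cong b2n e)) t.xs-len ; ys-len = cong₂ _+_ (≡-sym (cong (b2n ∘ not) e)) t.ys-len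
        ; sums = λ f → ≡-trans (+-assoc (f x) _ _) (cong (f x +_) (t.sums f)) }
      put false e = record { xs = t.xs ; ys = x ∷ t.ys ; xs-on = t.xs-on ; ys-on = e ∷ t.ys-on
        ; xs-len = cong₂ _+_ (≡-sym (cong b2n e)) t.xs-len ; ys-len = cong₂ _+_ (≡-sym (cong (b2n ∘ not) e)) t.ys-len
        ; sums = λ f → ≡-trans (+-left-comm (S f t.xs) (f x) (S f t.ys)) (cong (f x +_) (t.sums f)) }

    complete-success : sumᴸ (map suc αs) ≤ countF side → Success G
    complete-success h =
      let F , e , g , R , eq = build αs t.xs t.ys t.xs-on t.ys-on (≤-trans h (≤-reflexive (≡-sym xs≡))) (≤-trans h (≤-reflexive (≡-sym ys≡)))
      in record { fam = F ; indices = subst (_↭ αs) (≡-sym e) ↭-refl ; goods = g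
         ; once = λ v → ≤-trans (m≤m+n _ (S (δ v) R)) (≤-reflexive (≡-trans (eq (δ v))
                    (≡-trans (t.sums (δ v)) (≡-trans (S-tabulate (δ v) id) (totF-δ v))))) }
      where
      module t = Sides (sides (allFin m))
      xs≡ : length t.xs ≡ countF side
      xs≡ = ≡-trans t.xs-len (≡-trans (S-tabulate {m} _ id) (totF-count side))
      ys≡ : length t.ys ≡ countF side
      ys≡ = ≡-trans t.ys-len (≡-trans (S-tabulate {m} _ id) (≡-trans (totF-count (not ∘ side)) (≡-sym balanced)))

  pairs : List (Fin m × Fin m)
  pairs = cartesianProduct (allFin m) (allFin m)

  -- Adding all pairs makes the graph complete bipartite, where the family exists outright.
  not-not-success : ∀ G → Dense G → sumᴸ (map suc αs) ≤ countF side → (Success G → ⊥) → ⊥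
  not-not-success G d h = adds-success pairs d
    (Complete.complete-success (adds pairs G) (adds-edge pairs (∈-cartesianProduct⁺ (∈-allFin _) (∈-allFin _))) h)

-- Decidability of the existence of a system of cycles

module Decide {m} {side : Fin m → Bool} (G : Bipartite side) where

  open Fams G

  any-list? : ∀ n {P : List (Fin m) → Set} → (∀ L → Dec (P L)) → Dec (∃ λ L → length L ≤ n × P L)
  any-list? zero    P? = map′ (λ p → [] , z≤n , p) (λ { ([] , _ , p) → p }) (P? [])
  any-list? (suc n) {P} P? = map′ to from (P? [] ⊎-dec Fin.any? λ v → any-list? n (λ L → P? (v ∷ L)))
    where
    to : P [] ⊎ (∃ λ v → ∃ λ L → length L ≤ n × P (v ∷ L)) → ∃ λ L → length L ≤ suc n × P L
    to (inj₁ p)               = [] , z≤n , p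
    to (inj₂ (v , L , l , p)) = v ∷ L , s≤s l , p
    from : (∃ λ L → length L ≤ suc n × P L) → P [] ⊎ (∃ λ v → ∃ λ L → length L ≤ n × P (v ∷ L))
    from ([]    , l     , p) = inj₁ p
    from (v ∷ L , s≤s l , p) = inj₂ (v , L , l , p)

  walk? : ∀ r z L → Dec (∃ λ b → Path z (z ∷ L) b × b ~ r)
  walk? r z []      = map′ (λ e → z , [ z ] , e) (λ { (_ , [ _ ] , e) → e }) (edge G z r Bool.≟ true)
  walk? r z (y ∷ L) = map′ (λ { (e , b , P , q) → b , e ∷ P , q }) (λ { (b , e ∷ P , q) → first P e , b , path-start P , q })
                        ((edge G z y Bool.≟ true) ×-dec walk? r y L)
    where
    first : ∀ {a b} → Path a (y ∷ L) b → z ~ a → z ~ y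
    first [ _ ]   e = e
    first (_ ∷ _) e = e

  cyc? : ∀ L → Dec (Cyc L)
  cyc? []      = no λ { (_ , _ , () , _) }
  cyc? (x ∷ L) = map′ (λ { (b , P , e) → x , b , P , e }) (λ { (a , b , P , e) → b , path-start P , back P e }) (walk? x x L)
    where
    back : ∀ {a b} → Path a (x ∷ L) b → b ~ a → b ~ x
    back [ _ ]   e = e
    back (_ ∷ _) e = e

  good? : ∀ α L → Dec (Good (α , L))
  good? α L = cyc? L ×-dec (2 * suc α ≤? length L)

  -- `used` counts the visits by the cycles already chosen, so that the system can be decided one
  -- cycle at a time.
  Ordered : List ℕ → (Fin m → ℕ) → Set
  Ordered αs used = ∃ λ F → map proj₁ F ≡ αs × All Good F × (∀ v → used v + SF (δ v) F ≤ 1)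

  ordered? : ∀ αs used → Dec (Ordered αs used)
  ordered? []       used = map′ (λ h → [] , refl , [] , h) (λ { ([] , _ , _ , h) → h }) (Fin.all? λ v → used v + 0 ≤? 1)
  ordered? (α ∷ αs) used = map′ to from
    -- Lists of length at most `m` suffice, because a cycle of the system visits no vertex twice.
    (any-list? m λ L → good? α L ×-dec ordered? αs (λ v → used v + S (δ v) L))
    where
    to : (∃ λ L → length L ≤ m × Good (α , L) × Ordered αs (λ v → used v + S (δ v) L)) → Ordered (α ∷ αs) used
    to (L , _ , g , F , e , gs , h) =
      (α , L) ∷ F , cong (α ∷_) e , g ∷ gs , λ v → subst (_≤ 1) (+-assoc (used v) _ _) (h v)
    from : Ordered (α ∷ αs) used → ∃ λ L → length L ≤ m × Good (α , L) × Ordered αs (λ v → used v + S (δ v) L)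
    from ((α , L) ∷ F , refl , g ∷ gs , h) =
      L , short (complement L λ v → ≤-trans (≤-trans (m≤m+n (S (δ v) L) (SF (δ v) F)) (m≤n+m _ (used v))) (h v)) ,
      g , F , refl , gs , λ v → subst (_≤ 1) (≡-sym (+-assoc (used v) _ _)) (h v)
      where
      totF-1 : ∀ n → totF {n} (λ _ → 1) ≡ n
      totF-1 zero    = refl
      totF-1 (suc n) = cong suc (totF-1 n)
      short : (∃ λ R → ∀ f → S f L + S f R ≡ totF f) → length L ≤ m
      short (R , eq) = ≤-trans (≤-reflexive (≡-sym (S-1 L)))
        (≤-trans (m≤m+n _ (S (λ _ → 1) R)) (≤-reflexive (≡-trans (eq (λ _ → 1)) (totF-1 m))))

  S-lookup : ∀ L (i : Fin (length L)) → 1 ≤ S (δ (lookupᴸ L i)) L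
  S-lookup (x ∷ L) zero    = ≤-trans (≤-reflexive (≡-sym (δ-self x))) (m≤m+n _ _)
  S-lookup (x ∷ L) (suc i) = ≤-trans (S-lookup L i) (m≤n+m _ (δ (lookupᴸ L i) x))

  lookup-injective : ∀ L → (∀ v → S (δ v) L ≤ 1) → ∀ {i j} → lookupᴸ L i ≡ lookupᴸ L j → i ≡ j
  lookup-injective (x ∷ L) h {zero}  {zero}  e = refl
  lookup-injective (x ∷ L) h {zero}  {suc j} refl = ⊥-elim (<-irrefl refl
    (≤-trans (+-mono-≤ (≤-reflexive (≡-sym (δ-self (lookupᴸ L j)))) (S-lookup L j)) (h (lookupᴸ L j))))
  lookup-injective (x ∷ L) h {suc i} {zero}  refl = ⊥-elim (<-irrefl refl
    (≤-trans (+-mono-≤ (≤-reflexive (≡-sym (δ-self (lookupᴸ L i)))) (S-lookup L i)) (h (lookupᴸ L i))))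
  lookup-injective (x ∷ L) h {suc i} {suc j} e =
    cong suc (lookup-injective L (λ v → ≤-trans (m≤n+m _ (δ v x)) (h v)) e)

  path-step : ∀ {a x L b} → Path a (x ∷ L) b → ∀ (i : Fin (length L)) → lookupᴸ (x ∷ L) (inject₁ i) ~ lookupᴸ (x ∷ L) (suc i)
  path-step {L = y ∷ L} (e ∷ P) zero    = path-edge (e ∷ P)
  path-step {L = y ∷ L} (e ∷ P) (suc i) = path-step P i

  path-end : ∀ {a x L b} → Path a (x ∷ L) b → lookupᴸ (x ∷ L) (fromℕ (length L)) ≡ b
  path-end [ _ ]         = refl
  path-end (_ ∷ [ _ ])   = refl
  path-end (_ ∷ (e ∷ P)) = path-end (e ∷ P)

-- Cycles in the form of the statement

module _ {m} (H : Graph m) (side : Fin m → Bool) (bip : IsBipartition H side) where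

  as-bipartite : Bipartite side
  as-bipartite = record { edge = adj H ; edge-sym = Graph.sym H ; edge-bip = λ {u} {v} → bip u v }

  open Fams as-bipartite
  open Decide as-bipartite

  to-cycle : ∀ L → Cyc L → 3 ≤ length L → (∀ v → S (δ v) L ≤ 1) → Cycle H (length L)
  to-cycle []      (_ , _ , () , _) l h
  to-cycle (x ∷ L) (a , b , P , e) l h = record
    { p = length L ; len≡ = refl ; len≥3 = l ; vs = lookupᴸ (x ∷ L) ; inj = lookup-injective (x ∷ L) h
    ; step = path-step P ; close = subst₂ _~_ (≡-sym (path-end P)) (same-start P) e }
    where
    same-start : ∀ {a b} → Path a (x ∷ L) b → a ≡ x
    same-start [ _ ]   = refl
    same-start (_ ∷ _) = refl

  -- Occurrence of `v` on a cycle is expressed as weight at least 1, so two cycles through `v` would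
  -- exceed its total weight.
  record Cycles {k} (α : Fin k → ℕ) (F : Fam) : Set where
    field
      cyc      : Fin k → List (Fin m)
      good-cyc : ∀ j → Good (α j , cyc j)
      within   : ∀ f j → S f (cyc j) ≤ SF f F
      disjoint : ∀ v j j' → 1 ≤ S (δ v) (cyc j) → 1 ≤ S (δ v) (cyc j') → j ≡ j'

  to-cycles : ∀ {k} (α : Fin k → ℕ) F → map proj₁ F ≡ tabulate α → All Good F → (∀ v → SF (δ v) F ≤ 1) → Cycles α F
  to-cycles {zero}  α []            e gs       h = record { cyc = λ () ; good-cyc = λ () ; within = λ _ () ; disjoint = λ _ () }
  to-cycles {suc k} α ((a , L) ∷ F) e (g ∷ gs) h = record
    { cyc      = λ { zero → L ; (suc j) → c.cyc j }
    ; good-cyc = λ { zero → subst (λ t → Good (t , L)) (∷-injectiveˡ e) g ; (suc j) → c.good-cyc j }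
    ; within   = λ { f zero → m≤m+n (S f L) (SF f F) ; f (suc j) → ≤-trans (c.within f j) (m≤n+m (SF f F) (S f L)) }
    ; disjoint = λ { v zero zero _ _ → refl
                   ; v zero (suc j) p q → ⊥-elim (clash v j p q)
                   ; v (suc j) zero p q → ⊥-elim (clash v j q p)
                   ; v (suc j) (suc j') p q → cong suc (c.disjoint v j j' p q) } }
    where
    module c = Cycles (to-cycles (α ∘ suc) F (∷-injectiveʳ e) gs (λ v → ≤-trans (m≤n+m _ (S (δ v) L)) (h v)))
    clash : ∀ v j → 1 ≤ S (δ v) L → 1 ≤ S (δ v) (c.cyc j) → ⊥
    clash v j p q = <-irrefl refl (≤-trans (+-mono-≤ p (≤-trans q (c.within (δ v) j))) (h v))

  contains : ∀ {k} (cs : Vec ℕ k) (α : Fin k → ℕ) → (∀ j → lookup cs j ≡ 2 * suc (α j)) → (∀ j → 2 ≤ α j) →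
             Ordered (tabulate α) (λ _ → 0) → ContainsSubdivCycles H cs
  contains cs α cs≡ 2≤α (F , e , gs , h) =
    (λ j → length (cyc j)) , C , (λ j → ≤-trans (≤-reflexive (cs≡ j)) (proj₂ (good-cyc j))) ,
    λ j j' i i' q → disjoint (vs (C j) i) j j'
      (on-cycle (cyc j) (proj₁ (good-cyc j)) (long j) (single j) i)
      (subst (λ v → 1 ≤ S (δ v) (cyc j')) (≡-sym q) (on-cycle (cyc j') (proj₁ (good-cyc j')) (long j') (single j') i'))
    where
    open Cycles (to-cycles α F e gs h)
    long : ∀ j → 3 ≤ length (cyc j)
    long j = ≤-trans (≤-trans (s≤s (s≤s (s≤s z≤n))) (2 ⋆ s≤s (2≤α j))) (proj₂ (good-cyc j))
    single : ∀ j v → S (δ v) (cyc j) ≤ 1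
    single j v = ≤-trans (within (δ v) j) (h v)
    C : ∀ j → Cycle H (length (cyc j))
    C j = to-cycle (cyc j) (proj₁ (good-cyc j)) (long j) (single j)
    on-cycle : ∀ L c l s i → 1 ≤ S (δ (vs (to-cycle L c l s) i)) L
    on-cycle []      (_ , _ , () , _) l s i
    on-cycle (x ∷ L) c                l s i = S-lookup (x ∷ L) i

-- A length 2 q with q ≥ 3 gets the index q - 1. Summed up, n / 2 = Σ α_j + k, which turns n / 2 - k
-- + 1 into Σ α_j + 1.
requirements : ∀ {k} (cs : Vec ℕ k) → (∀ j → 2 ∣ lookup cs j) → (∀ j → 6 ≤ lookup cs j) →
               ∃ λ (α : Fin k → ℕ) → (∀ j → lookup cs j ≡ 2 * suc (α j)) × (∀ j → 2 ≤ α j) ×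
                                     sum cs ≡ 2 * (sumᴸ (tabulate α) + k)
requirements []       h₂ h₆ = (λ ()) , (λ ()) , (λ ()) , refl
requirements {suc k} (c ∷ cs) h₂ h₆ with requirements cs (h₂ ∘ suc) (h₆ ∘ suc) | h₂ zero | h₆ zero
... | _ | divides 1 refl | s≤s (s≤s ())
... | _ | divides 2 refl | s≤s (s≤s (s≤s (s≤s ())))
... | α , e , 2≤ , s | divides (suc (suc (suc q))) refl | _ =
  (λ { zero → suc (suc q) ; (suc j) → α j }) ,
  (λ { zero → *-comm (suc (suc (suc q))) 2 ; (suc j) → e j }) ,
  (λ { zero → s≤s (s≤s z≤n) ; (suc j) → 2≤ j }) ,
  ≡-trans (cong (suc (suc (suc q)) * 2 +_) s) (ar q (sumᴸ (tabulate α)) k)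
  where
  ar : ∀ q t k → suc (suc (suc q)) * 2 + 2 * (t + k) ≡ 2 * (suc (suc q) + t + suc k)
  ar = solve-∀

theorem3 : (n k : ℕ) → 6 ≤ n → 1 ≤ k →
    (cs : Vec ℕ k) → sum cs ≡ n →
    (∀ j → 2 ∣ lookup cs j) → (∀ j → 6 ≤ lookup cs j) →
    (m : ℕ) (G : Graph m) (side : Fin m → Bool) → IsBipartition G side →
    countF side ≡ countF (λ v → not (side v)) → n ≤ 2 * countF side →
    -- δ(G) ≥ n/2 − k + 1, written without truncated subtraction
    (∀ v → suc ⌊ n /2⌋ ≤ degree G v + k) →
    ContainsSubdivCycles G cs
theorem3 n k _ _ cs sum≡ even 6≤ m G side bip balanced order δ≥ with requirements cs even 6≤
... | α , cs≡ , 2≤α , total≡ = conclude (Decide.ordered? B αs (λ _ → 0))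
  where
  αs = tabulate α
  B = as-bipartite G side bip
  open Target side αs (tabulate⁺ 2≤α) balanced
  n≡ : n ≡ 2 * (sumᴸ αs + k)
  n≡ = ≡-trans (≡-sym sum≡) total≡
  half≡ : ⌊ n /2⌋ ≡ sumᴸ αs + k
  half≡ = ≡-trans (cong ⌊_/2⌋ n≡) (≡-trans (cong (λ t → ⌊ sumᴸ αs + k + t /2⌋) (+-identityʳ _)) (≡-sym (n≡⌊n+n/2⌋ (sumᴸ αs + k))))
  dense : Dense B
  dense u = ≤-trans (+-cancelʳ-≤ k _ _ (subst (λ t → suc t ≤ degree G u + k) half≡ (δ≥ u))) (≤-reflexive (≡-sym (totF-count (adj G u))))
  sum-suc : ∀ {k} (α : Fin k → ℕ) → sumᴸ (map suc (tabulate α)) ≡ sumᴸ (tabulate α) + k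
  sum-suc {zero}  α = refl
  sum-suc {suc k} α = ≡-trans (cong (suc (α zero) +_) (sum-suc (α ∘ suc))) (ar (α zero) (sumᴸ (tabulate (α ∘ suc))) k)
    where
    ar : ∀ a t k → suc a + (t + k) ≡ a + t + suc k
    ar = solve-∀
  room : sumᴸ (map suc αs) ≤ countF side
  room = *-cancelˡ-≤ 2 (≤-trans (≤-reflexive (≡-trans (cong (2 *_) (sum-suc α)) (≡-sym n≡))) order)
  reorder : Success B → Decide.Ordered B αs (λ _ → 0)
  reorder σ with ↭-map-inv proj₁ (Success.indices σ)
  ... | F , e , p = F , ≡-sym e , All-resp-↭ p (Success.goods σ) ,
                    λ v → ≤-trans (≤-reflexive (FamilySums.ΣF-↭ _ (↭-sym p))) (Success.once σ v)
  conclude : Dec (Decide.Ordered B αs (λ _ → 0)) → ContainsSubdivCycles G cs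
  conclude (yes o) = contains G side bip cs α cs≡ 2≤α o
  conclude (no ¬o) = ⊥-elim (not-not-success B dense room (¬o ∘ reorder))
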